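{- Let $\mathbf{A}$ be a finite semilattice-based algebra of finite signature such that the pseudovariety generated by $\mathbf{A}$ has only finitely many subdirectly irreducible members (up to isomorphism). Then the pseudovariety generated by $\mathbf{A}$ is definable in first order logic amongst finite structures, that is, there is a first order sentence whose finite models are exactly the members of $\mathsf{HSP}_{\rm fin}(\mathbf{A})$.
   Context: An algebra is semilattice-based if its fundamental operations include a binary operation satisfying the semilattice axioms (idempotent, commutative, associative). A pseudovariety is a class of finite algebras of the same signature closed under homomorphic images, isomorphic copies of subalgebras and finitary direct products; the pseudovariety generated by $\mathbf{A}$ is $\mathsf{HSP}_{\rm fin}(\mathbf{A})$. An algebra is subdirectly irreducible if it has a unique minimum nontrivial congruence (equivalently, there is a pair of distinct elements contained in every principal congruence generated by a pair of distinct elements). -}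

module Defs where

open import Algebra.Lattice.Structures using (IsSemilattice)
open import Data.Empty using (⊥)
open import Data.Fin.Base using (Fin; zero; suc)
open import Data.Fin.Properties using (1↔⊤; *↔×)
open import Data.List.Base using (List)
open import Data.List.Relation.Unary.Any using (Any)
open import Data.Nat.Base using (ℕ; zero; suc; _*_)
open import Data.Product.Base using (Σ-syntax; ∃-syntax; _×_; _,_; proj₁; proj₂)
open import Data.Product.Function.NonDependent.Propositional using (_×-↔_)
open import Data.Sum.Base using (_⊎_)
open import Data.Unit.Base using (⊤; tt)
open import Data.Vec.Base using (Vec; []; _∷_; lookup; map)
open import Data.Vec.Relation.Binary.Pointwise.Inductive using (Pointwise)
open import Function.Base using (_∘_)
open import Function.Bundles using (_↔_)
open import Function.Definitions using (Injective; Surjective; Bijective)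
open import Function.Properties.Inverse using (↔-sym; ↔-trans)
open import Level using (0ℓ)
open import Relation.Binary.Core using (Rel; _⇒_)
open import Relation.Binary.Structures using (IsEquivalence)
open import Relation.Binary.PropositionalEquality using (_≡_; _≢_; refl; sym; subst)

Finite : Set → Set
Finite X = ∃[ n ] (X ↔ Fin n)

record Signature : Set₁ where
  field
    Op    : Set
    arity : Op → ℕ

open Signature public

-- The field `point` records the convention that algebras are nonempty; it
-- is not part of the signature, and homomorphisms need not preserve it.
record Algebra (S : Signature) : Set₁ where
  field
    Carrier : Set
    op      : (f : Op S) → Vec Carrier (arity S f) → Carrier
    point   : Carrier

record FiniteAlgebra (S : Signature) : Set₁ where
  field
    algebra : Algebra S
  open Algebra algebra public
  field
    finite : Finite Carrier

open FiniteAlgebra public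

module _ {S : Signature} where

  SemilatticeBased : FiniteAlgebra S → Set
  SemilatticeBased A =
    Σ[ f ∈ Op S ] Σ[ binary ∈ arity S f ≡ 2 ]
      IsSemilattice _≡_ (λ x y → op A f (subst (Vec (Carrier A)) (sym binary) (x ∷ y ∷ [])))

  IsHomomorphism : (A B : FiniteAlgebra S) → (Carrier A → Carrier B) → Set
  IsHomomorphism A B h =
    ∀ f (xs : Vec (Carrier A) (arity S f)) → h (op A f xs) ≡ op B f (map h xs)

  infix 4 _↠_ _↪_ _≅_

  _↠_ : FiniteAlgebra S → FiniteAlgebra S → Set
  A ↠ B = ∃[ h ] (IsHomomorphism A B h × Surjective _≡_ _≡_ h)

  _↪_ : FiniteAlgebra S → FiniteAlgebra S → Set
  A ↪ B = ∃[ h ] (IsHomomorphism A B h × Injective _≡_ _≡_ h)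

  _≅_ : FiniteAlgebra S → FiniteAlgebra S → Set
  A ≅ B = ∃[ h ] (IsHomomorphism A B h × Bijective _≡_ _≡_ h)

  𝟙 : FiniteAlgebra S
  𝟙 = record
    { algebra = record { Carrier = ⊤ ; op = λ _ _ → tt ; point = tt }
    ; finite  = 1 , ↔-sym 1↔⊤
    }

  infixr 5 _⊗_

  _⊗_ : FiniteAlgebra S → FiniteAlgebra S → FiniteAlgebra S
  A ⊗ B = record
    { algebra = record
      { Carrier = Carrier A × Carrier B
      ; op      = λ f xs → op A f (map proj₁ xs) , op B f (map proj₂ xs)
      ; point   = point A , point B
      }
    ; finite  = let (m , A↔m) = finite A ; (n , B↔n) = finite B in
                m * n , ↔-trans (A↔m ×-↔ B↔n) (↔-sym *↔×)
    }

  -- Iterated binary products are used instead of dependent functions on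
  -- Fin k, since the latter are not a finite type without extensionality.
  ∏ : ∀ {k} → (Fin k → FiniteAlgebra S) → FiniteAlgebra S
  ∏ {zero}  C = 𝟙
  ∏ {suc k} C = C zero ⊗ ∏ (C ∘ suc)

  Class : Set₂
  Class = FiniteAlgebra S → Set₁

  H : Class → Class
  H K B = ∃[ C ] (K C × C ↠ B)

  -- Isomorphic copies of subalgebras are the algebras that embed.
  𝕊 : Class → Class
  𝕊 K B = ∃[ C ] (K C × B ↪ C)

  Pfin : Class → Class
  Pfin K B = ∃[ k ] Σ[ C ∈ (Fin k → FiniteAlgebra S) ] ((∀ i → K (C i)) × B ≅ ∏ C)

  HSPfin : FiniteAlgebra S → Class
  HSPfin A = H (𝕊 (Pfin (A ≡_)))

  record IsCongruence (A : FiniteAlgebra S) (θ : Rel (Carrier A) 0ℓ) : Set where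
    field
      isEquivalence : IsEquivalence θ
      compatible    : ∀ f {xs ys : Vec (Carrier A) (arity S f)} →
                      Pointwise θ xs ys → θ (op A f xs) (op A f ys)

  Nontrivial : (A : FiniteAlgebra S) → Rel (Carrier A) 0ℓ → Set
  Nontrivial A θ = ∃[ a ] ∃[ b ] (a ≢ b × θ a b)

  SubdirectlyIrreducible : Class
  SubdirectlyIrreducible A =
    Σ[ μ ∈ Rel (Carrier A) 0ℓ ]
      IsCongruence A μ × Nontrivial A μ ×
      (∀ (θ : Rel (Carrier A) 0ℓ) → IsCongruence A θ → Nontrivial A θ → μ ⇒ θ)

  FinitelyManyUpToIso : Class → Set₁
  FinitelyManyUpToIso K =
    Σ[ Bs ∈ List (FiniteAlgebra S) ] (∀ B → K B → Any (B ≅_) Bs)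

-- First-order logic with equality over an algebraic signature; variables
-- are de Bruijn indices, and n bounds the free variables.
data Term (S : Signature) (n : ℕ) : Set where
  var : Fin n → Term S n
  app : (f : Op S) → Vec (Term S n) (arity S f) → Term S n

infix  7 _≐_
infixr 6 _∧′_
infixr 5 _∨′_
infixr 4 _⇒′_

data Formula (S : Signature) (n : ℕ) : Set where
  _≐_            : Term S n → Term S n → Formula S n
  ⊥′             : Formula S n
  _∧′_ _∨′_ _⇒′_ : Formula S n → Formula S n → Formula S n
  ∀′ ∃′          : Formula S (suc n) → Formula S n

Sentence : Signature → Set
Sentence S = Formula S 0

module _ {S : Signature} (A : FiniteAlgebra S) where

  eval  : ∀ {n} → Vec (Carrier A) n → Term S n → Carrier A
  evals : ∀ {n k} → Vec (Carrier A) n → Vec (Term S n) k → Vec (Carrier A) k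

  eval ρ (var i)    = lookup ρ i
  eval ρ (app f ts) = op A f (evals ρ ts)

  evals ρ []       = []
  evals ρ (t ∷ ts) = eval ρ t ∷ evals ρ ts

  Holds : ∀ {n} → Vec (Carrier A) n → Formula S n → Set
  Holds ρ (s ≐ t)  = eval ρ s ≡ eval ρ t
  Holds ρ ⊥′       = ⊥
  Holds ρ (φ ∧′ ψ) = Holds ρ φ × Holds ρ ψ
  Holds ρ (φ ∨′ ψ) = Holds ρ φ ⊎ Holds ρ ψ
  Holds ρ (φ ⇒′ ψ) = Holds ρ φ → Holds ρ ψ
  Holds ρ (∀′ φ)   = ∀ a → Holds (a ∷ ρ) φ
  Holds ρ (∃′ φ)   = ∃[ a ] Holds (a ∷ ρ) φ

infix 4 _⊨_

_⊨_ : ∀ {S} → FiniteAlgebra S → Sentence S → Set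
A ⊨ φ = Holds A [] φ

{-# OPTIONS --safe #-}
module Submission where

-- A homomorphism h from a finite semilattice-based algebra B onto a finite
-- algebra L is definable with |L| parameters: the preimage of the principal
-- filter of l is a filter of B, hence principal, so h x ≥ l iff x ≥ p l for
-- its least element p l. Every member of the pseudovariety K of A is separated
-- by homomorphisms onto subdirectly irreducible members, of which there are
-- finitely many, so B ∈ K iff for all a ≢ b some parameters p define a
-- homomorphism onto one of these members that separates a and b; this is a
-- first-order condition. To drop the listed algebras outside K, membership
-- in K must be decided: L ∈ K iff L is a quotient of a subalgebra of
-- A^(|A|^|L|).

open import Defs
open import Algebra.Definitions using (Associative; Commutative; Idempotent)
open import Algebra.Lattice.Structures using (IsSemilattice)
open import Data.Bool.Base using (Bool; true; false; T)
open import Data.Bool.Properties using (T-irrelevant)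
open import Data.Fin.Base using (Fin; zero; suc; _↑ˡ_; _↑ʳ_; splitAt; finToFun; funToFin)
open import Data.Fin.Properties using (*↔×; +↔⊎; 0↔⊥; 1↔⊤; 2↔Bool; splitAt-↑ˡ; splitAt-↑ʳ; finToFun-funToFin)
import Data.Fin.Properties as Fin
open import Data.Fin.Subset using (Subset; _∈_; _⊆_; _⊂_; _∪_; ⁅_⁆)
open import Data.Fin.Subset.Induction using (Acc; acc; ⊃-wellFounded)
open import Data.Fin.Subset.Properties using (_∈?_; _⊂?_; anySubset?; x∈⁅x⁆; x∈⁅y⁆⇒x≡y; p⊆p∪q; x∈p∪q⁺; x∈p∪q⁻; ⊆-antisym)
open import Data.List.Base as List using (length)
open import Data.List.Relation.Unary.Any as Any using (Any)
open import Data.List.Relation.Unary.Any.Properties using (lookup-index)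
open import Data.Nat.Base using (ℕ; zero; suc; _+_; _*_; _^_)
open import Data.Product.Base using (Σ-syntax; ∃; ∃-syntax; _×_; _,_; proj₁; proj₂; uncurry; map₂)
open import Data.Product.Function.Dependent.Propositional using (Σ-↔)
open import Data.Product.Function.NonDependent.Propositional using (_×-↔_; _×-⇔_)
open import Data.Sum.Base using (_⊎_; inj₁; inj₂; [_,_]′)
open import Data.Sum.Function.Propositional using (_⊎-↔_; _⊎-⇔_)
open import Data.Unit.Base using (⊤; tt)
open import Data.Vec.Base using (Vec; []; _∷_; lookup; map; tabulate; head; tail; _++_)
open import Data.Vec.Properties using (map-∘; map-cong; map-id; lookup∘tabulate; []=⇒lookup; lookup⇒[]=; lookup-map; lookup-++ˡ; lookup-++ʳ; tabulate∘lookup; tabulate-cong)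
open import Data.Vec.Relation.Binary.Pointwise.Inductive as Pointwise using (Pointwise; []; _∷_)
open import Function.Base using (_∘_; id; const)
open import Function.Bundles using (_↔_; _⇔_; mk⇔; mk↔ₛ′; Inverse; Equivalence)
open import Function.Construct.Composition using (_⇔-∘_)
open import Function.Construct.Identity using (⇔-id)
open import Function.Properties.Inverse using (↔-sym; ↔-trans; ↔-refl; ↔⇒↣)
open import Function.Related.Propositional using (K-reflexive)
open import Function.Related.TypeIsomorphisms using (→-cong-⇔)
open import Level using (0ℓ)
import Relation.Binary.Construct.NaturalOrder.Left as NaturalOrder
open import Relation.Binary.Core using (Rel; REL; _⇒_)
open import Relation.Binary.Definitions using (DecidableEquality) renaming (Decidable to Decidable₂)
open import Relation.Binary.PropositionalEquality using (_≡_; _≢_; refl; sym; trans; cong; cong₂; subst; module ≡-Reasoning)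
import Relation.Binary.PropositionalEquality as ≡
open import Relation.Binary.Structures using (IsEquivalence)
open import Relation.Nullary.Decidable using (Dec; yes; no; does; True; toWitness; fromWitness; map′; via-injection; decidable-stable; ¬?; _×-dec_; _→-dec_; T?; toSum)
open import Relation.Nullary.Negation using (¬_; contradiction)
open import Relation.Unary using (Pred; Decidable)

open Inverse using (to; from; strictlyInverseˡ; strictlyInverseʳ)
open Equivalence using () renaming (to to to⇔; from to from⇔)

-- `FinitelyManyUpToIso` lets the list contain algebras outside K, and homomorphisms into those
-- prove nothing about B. The exponent |A|^|L| counts the functions from L to A: once a preimage of
-- every element of L is fixed, a coordinate of a power of A matters only through the function L → A
-- that it induces on these preimages. The sentence is evaluated in arbitrary finite B, where the
-- meet may violate the semilattice laws and least elements may not exist. So it never says that the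
-- parameters are least; it says that the sets they cut out behave like the fibres of a
-- homomorphism. Least elements only show that members of K have such parameters. The logic is
-- constructive, and subdirect irreducibility quantifies over arbitrary, possibly undecidable,
-- congruences. Congruences are therefore handled as subsets of the finite type of pairs, and
-- membership in K as a relation between a power of A and the algebra, which can be enumerated,
-- pulled back and intersected.

Finite-≟ : ∀ {X : Set} → Finite X → DecidableEquality X
Finite-≟ (_ , X↔n) = via-injection (↔⇒↣ X↔n) Fin._≟_

Finite-any? : ∀ {X : Set} → Finite X → ∀ {p} {P : Pred X p} → Decidable P → Dec (∃ P)
Finite-any? (_ , X↔n) {P = P} P? = map′
  (λ (i , p) → from X↔n i , p)
  (λ (x , p) → to X↔n x , subst P (sym (strictlyInverseʳ X↔n x)) p)
  (Fin.any? (P? ∘ from X↔n))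

Finite-all? : ∀ {X : Set} → Finite X → ∀ {p} {P : Pred X p} → Decidable P → Dec (∀ x → P x)
Finite-all? (_ , X↔n) {P = P} P? = map′
  (λ p x → subst P (strictlyInverseʳ X↔n x) (p (to X↔n x)))
  (λ p i → p (from X↔n i))
  (Fin.all? (P? ∘ from X↔n))

all-or-counterexample : ∀ {X : Set} → Finite X → ∀ {p} {P : Pred X p} → Decidable P →
  (∀ x → P x) ⊎ (∃[ x ] ¬ P x)
all-or-counterexample F P? with Finite-any? F (¬? ∘ P?)
... | yes cex = inj₂ cex
... | no ¬cex = inj₁ λ x → decidable-stable (P? x) λ ¬p → ¬cex (x , ¬p)

Finite-× : ∀ {X Y : Set} → Finite X → Finite Y → Finite (X × Y)
Finite-× (m , X↔m) (n , Y↔n) = m * n , ↔-trans (X↔m ×-↔ Y↔n) (↔-sym *↔×)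

Finite-Vec : ∀ {X : Set} → Finite X → ∀ k → Finite (Vec X k)
Finite-Vec F zero    = 1 , ↔-trans (mk↔ₛ′ (λ _ → tt) (λ _ → []) (λ _ → refl) (λ { [] → refl })) (↔-sym 1↔⊤)
Finite-Vec F (suc k) =
  let n , X×Xs↔n = Finite-× F (Finite-Vec F k) in
  n , ↔-trans (mk↔ₛ′ (λ { (x ∷ xs) → x , xs }) (uncurry _∷_) (λ _ → refl) (λ { (x ∷ xs) → refl })) X×Xs↔n

Finite-Subset : ∀ n → Finite (Subset n)
Finite-Subset = Finite-Vec (2 , ↔-sym 2↔Bool)

T-finite : ∀ b → Finite (T b)
T-finite false = 0 , ↔-sym 0↔⊥
T-finite true  = 1 , ↔-sym 1↔⊤

Fin-Σ-T-finite : ∀ {n} (b : Fin n → Bool) → Finite (∃[ i ] T (b i))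
Fin-Σ-T-finite {zero}  b = 0 , mk↔ₛ′ (λ { (() , _) }) (λ ()) (λ ()) (λ { (() , _) })
Fin-Σ-T-finite {suc n} b =
  let k , T↔k = T-finite (b zero)
      m , Σ↔m = Fin-Σ-T-finite (b ∘ suc)
  in k + m , ↔-trans split (↔-trans (T↔k ⊎-↔ Σ↔m) (↔-sym +↔⊎))
  where
  split : (∃[ i ] T (b i)) ↔ (T (b zero) ⊎ (∃[ i ] T (b (suc i))))
  split = mk↔ₛ′
    (λ { (zero , t) → inj₁ t ; (suc i , t) → inj₂ (i , t) })
    [ (λ t → zero , t) , (λ (i , t) → suc i , t) ]′
    (λ { (inj₁ t) → refl ; (inj₂ _) → refl })
    (λ { (zero , t) → refl ; (suc i , t) → refl })

Finite-Σ-T : ∀ {X : Set} → Finite X → (b : X → Bool) → Finite (∃[ x ] T (b x))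
Finite-Σ-T (_ , X↔n) b =
  let m , Σ↔m = Fin-Σ-T-finite (b ∘ from X↔n) in
  m , ↔-trans (Σ-↔ X↔n (λ {x} → K-reflexive (cong (T ∘ b) (sym (strictlyInverseʳ X↔n x))))) Σ↔m

-- Subalgebras and quotients get carriers of this shape: proofs of `True` are unique, so no proof
-- component can distinguish two elements.
Σ-True-≡ : ∀ {X : Set} {P : Pred X 0ℓ} {P? : Decidable P} {x y : ∃[ z ] True (P? z)} →
  proj₁ x ≡ proj₁ y → x ≡ y
Σ-True-≡ refl = cong (_ ,_) (T-irrelevant _ _)

-- Decidable predicates as finite subsets

module FiniteSubset {X : Set} (F : Finite X) where

  infix 4 _∈ˢ_ _∈ˢ?_

  _∈ˢ_ : X → Subset (proj₁ F) → Set
  x ∈ˢ s = to (proj₂ F) x ∈ s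

  _∈ˢ?_ : Decidable₂ _∈ˢ_
  x ∈ˢ? s = to (proj₂ F) x ∈? s

  module _ {P : Pred X 0ℓ} (P? : Decidable P) where

    comprehension : Subset (proj₁ F)
    comprehension = tabulate (does ∘ P? ∘ from (proj₂ F))

    private
      lookup-comprehension : ∀ x → lookup comprehension (to (proj₂ F) x) ≡ does (P? x)
      lookup-comprehension x =
        trans (lookup∘tabulate _ (to (proj₂ F) x)) (cong (does ∘ P?) (strictlyInverseʳ (proj₂ F) x))

    ∈-comprehension⁺ : ∀ {x} → P x → x ∈ˢ comprehension
    ∈-comprehension⁺ {x} p with P? x | lookup-comprehension x
    ... | yes _ | eq = lookup⇒[]= _ _ eq
    ... | no ¬p | _  = contradiction p ¬p

    ∈-comprehension⁻ : ∀ {x} → x ∈ˢ comprehension → P x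
    ∈-comprehension⁻ {x} x∈ with P? x | lookup-comprehension x
    ... | yes p | _  = p
    ... | no  _ | eq with () ← trans (sym ([]=⇒lookup x∈)) eq

  ∈ˢ⇒⊆ : ∀ {s t} → (∀ x → x ∈ˢ s → x ∈ˢ t) → s ⊆ t
  ∈ˢ⇒⊆ {s} {t} s⊆t {i} i∈s =
    subst (_∈ t) (strictlyInverseˡ (proj₂ F) i)
      (s⊆t (from (proj₂ F) i) (subst (_∈ s) (sym (strictlyInverseˡ (proj₂ F) i)) i∈s))

  ∈ˢ-ext : ∀ {s t} → (∀ x → x ∈ˢ s → x ∈ˢ t) → (∀ x → x ∈ˢ t → x ∈ˢ s) → s ≡ t
  ∈ˢ-ext s⊆t t⊆s = ⊆-antisym (∈ˢ⇒⊆ s⊆t) (∈ˢ⇒⊆ t⊆s)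

-- Strict growth inside a finite set must stop. This replaces both the closure under generation and
-- the choice of a maximal element in the work with congruences.
ascend : ∀ {n p q} {P : Pred (Subset n) p} {Q : Pred (Subset n) q} →
  (∀ s → P s → Q s ⊎ (∃[ t ] (s ⊂ t × P t))) → ∀ s → P s → ∃[ t ] (P t × Q t)
ascend {P = P} {Q} step s = climb s (⊃-wellFounded s)
  where
  climb : ∀ s → Acc _ s → P s → ∃[ t ] (P t × Q t)
  climb s (acc larger) p with step s p
  ... | inj₁ q               = s , p , q
  ... | inj₂ (t , s⊂t , p′) = climb t (larger s⊂t) p′

Functional : ∀ {X Y : Set} → REL X Y 0ℓ → Set
Functional G = ∀ {u b b′} → G u b → G u b′ → b ≡ b′

-- Homomorphisms, powers and covers

module _ {S : Signature} where

  id-hom : (A : FiniteAlgebra S) → IsHomomorphism A A id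
  id-hom A f xs = cong (op A f) (sym (map-id xs))

  ∘-hom : (A B C : FiniteAlgebra S) {g : Carrier B → Carrier C} {h : Carrier A → Carrier B} →
    IsHomomorphism B C g → IsHomomorphism A B h → IsHomomorphism A C (g ∘ h)
  ∘-hom A B C {g} {h} g-hom h-hom f xs =
    trans (cong g (h-hom f xs)) (trans (g-hom f (map h xs)) (cong (op C f) (sym (map-∘ g h xs))))

  ↠-trans : (A B C : FiniteAlgebra S) → A ↠ B → B ↠ C → A ↠ C
  ↠-trans A B C (h , h-hom , h-surj) (g , g-hom , g-surj) =
    g ∘ h , ∘-hom A B C g-hom h-hom , λ z →
      let y , gy≡z = g-surj z
          x , hx≡y = h-surj y
      in x , λ { refl → gy≡z (hx≡y refl) }

  proj : ∀ {k} (C : Fin k → FiniteAlgebra S) i → Carrier (∏ C) → Carrier (C i)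
  proj C zero    u = proj₁ u
  proj C (suc i) u = proj (C ∘ suc) i (proj₂ u)

  proj-hom : ∀ {k} (C : Fin k → FiniteAlgebra S) i → IsHomomorphism (∏ C) (C i) (proj C i)
  proj-hom C zero    f us = refl
  proj-hom C (suc i) f us =
    trans (proj-hom (C ∘ suc) i f (map proj₂ us)) (cong (op (C (suc i)) f) (sym (map-∘ _ proj₂ us)))

  proj-ext : ∀ {k} (C : Fin k → FiniteAlgebra S) {u v : Carrier (∏ C)} →
    (∀ i → proj C i u ≡ proj C i v) → u ≡ v
  proj-ext {zero}  C eq = refl
  proj-ext {suc k} C eq = cong₂ _,_ (eq zero) (proj-ext (C ∘ suc) (eq ∘ suc))

  tuple : ∀ {k} (C : Fin k → FiniteAlgebra S) → (∀ i → Carrier (C i)) → Carrier (∏ C)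
  tuple {zero}  C x = tt
  tuple {suc k} C x = x zero , tuple (C ∘ suc) (x ∘ suc)

  proj-tuple : ∀ {k} (C : Fin k → FiniteAlgebra S) (x : ∀ i → Carrier (C i)) i →
    proj C i (tuple C x) ≡ x i
  proj-tuple C x zero    = refl
  proj-tuple C x (suc i) = proj-tuple (C ∘ suc) (x ∘ suc) i

  tuple-hom : ∀ {k} (A : FiniteAlgebra S) (C : Fin k → FiniteAlgebra S)
    {h : ∀ i → Carrier A → Carrier (C i)} → (∀ i → IsHomomorphism A (C i) (h i)) →
    IsHomomorphism A (∏ C) (λ x → tuple C (λ i → h i x))
  tuple-hom A C {h} h-hom f xs = proj-ext C λ i → begin
    proj C i (tuple C (λ i → h i (op A f xs)))       ≡⟨ proj-tuple C _ i ⟩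
    h i (op A f xs)                                  ≡⟨ h-hom i f xs ⟩
    op (C i) f (map (h i) xs)                        ≡⟨ cong (op (C i) f) (map-cong (λ x → proj-tuple C _ i) xs) ⟨
    op (C i) f (map (proj C i ∘ ⟨h⟩) xs)             ≡⟨ cong (op (C i) f) (map-∘ _ _ xs) ⟩
    op (C i) f (map (proj C i) (map ⟨h⟩ xs))         ≡⟨ proj-hom C i f _ ⟨
    proj C i (op (∏ C) f (map ⟨h⟩ xs))               ∎
    where
    open ≡-Reasoning
    ⟨h⟩ : Carrier A → Carrier (∏ C)
    ⟨h⟩ x = tuple C (λ i → h i x)

  infixl 8 _^ᴬ_

  _^ᴬ_ : FiniteAlgebra S → ℕ → FiniteAlgebra S
  A ^ᴬ k = ∏ {k = k} (const A)

  module _ (A : FiniteAlgebra S) where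

    -- Covers move between powers only by pulling back along such maps: `cover-boundedPower` uses it
    -- to merge equal coordinates, `_∩ᶜ_` to select one of two blocks.
    reindex : ∀ {k l} → (Fin k → Fin l) → Carrier (A ^ᴬ l) → Carrier (A ^ᴬ k)
    reindex j u = tuple (const A) (λ i → proj (const A) (j i) u)

    reindex-hom : ∀ {k l} (j : Fin k → Fin l) → IsHomomorphism (A ^ᴬ l) (A ^ᴬ k) (reindex j)
    reindex-hom {l = l} j = tuple-hom (A ^ᴬ l) (const A) (λ i → proj-hom (const A) (j i))

    reindex-tuple : ∀ {k l} (j : Fin k → Fin l) (x : Fin l → Carrier A) (u : Carrier (A ^ᴬ k)) →
      (∀ i → x (j i) ≡ proj (const A) i u) → reindex j (tuple (const A) x) ≡ u
    reindex-tuple j x u eq = proj-ext (const A) λ i →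
      trans (proj-tuple (const A) _ i) (trans (proj-tuple (const A) x (j i)) (eq i))

    -- Without function extensionality `C` cannot be rewritten to `const A`, so each coordinate is
    -- transported on its own.
    ∏-↪-^ : ∀ {k} (C : Fin k → FiniteAlgebra S) → (∀ i → A ≡ C i) → ∏ C ↪ A ^ᴬ k
    ∏-↪-^ C A≡C =
      (λ u → tuple (const A) (λ i → coerce (A≡C i) (proj C i u))) ,
      tuple-hom (∏ C) (const A) (λ i → ∘-hom (∏ C) (C i) A (coerce-hom (A≡C i)) (proj-hom C i)) ,
      λ eq → proj-ext C λ i → coerce-injective (A≡C i)
        (trans (sym (proj-tuple (const A) _ i)) (trans (cong (proj (const A) i) eq) (proj-tuple (const A) _ i)))
      where
      coerce : ∀ {B} → A ≡ B → Carrier B → Carrier A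
      coerce refl = id
      coerce-hom : ∀ {B} (A≡B : A ≡ B) → IsHomomorphism B A (coerce A≡B)
      coerce-hom refl = id-hom A
      coerce-injective : ∀ {B} (A≡B : A ≡ B) {x y} → coerce A≡B x ≡ coerce A≡B y → x ≡ y
      coerce-injective refl = id

    𝕊Pfin⇒↪-^ : ∀ {B} → 𝕊 (Pfin (A ≡_)) B → ∃[ k ] B ↪ A ^ᴬ k
    𝕊Pfin⇒↪-^ {B} (D , (k , C , A≡C , e , e-hom , e-injective , _) , d , d-hom , d-injective) =
      let c , c-hom , c-injective = ∏-↪-^ C A≡C in
      k , c ∘ e ∘ d ,
      ∘-hom B D (A ^ᴬ k) (∘-hom D (∏ C) (A ^ᴬ k) c-hom e-hom) d-hom ,
      d-injective ∘ e-injective ∘ c-injective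

  -- A cover of B by A^k is a subalgebra of A^k × B that projects onto B; a
  -- cover that is the graph of a partial function exhibits B as a quotient of
  -- a subalgebra of A^k.
  record IsCover (A B : FiniteAlgebra S) k (G : REL (Carrier (A ^ᴬ k)) (Carrier B) 0ℓ) : Set where
    field
      closed : ∀ f {us bs} → Pointwise G us bs → G (op (A ^ᴬ k) f us) (op B f bs)
      onto   : ∀ b → ∃[ u ] G u b

  -- Decidability makes the graph a finite carrier. Being functional is kept apart, because the
  -- covers that are intersected below become functional only jointly.
  record Cover (A B : FiniteAlgebra S) : Set₁ where
    field
      power   : ℕ
      _∼_     : REL (Carrier (A ^ᴬ power)) (Carrier B) 0ℓ
      _∼?_    : Decidable₂ _∼_
      isCover : IsCover A B power _∼_
    open IsCover isCover public

  open Cover using (power; _∼_; _∼?_; closed; onto)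

  -- If `h` maps C onto B and `e` embeds C in a power of A, the relation is the image of C under the
  -- pairing of `e` and `h`. Injectivity of `e` makes it functional.
  HSPfin⇒cover : ∀ A B → HSPfin A B → Σ[ 𝒞 ∈ Cover A B ] Functional (_∼_ 𝒞)
  HSPfin⇒cover A B (C , C∈𝕊P , h , h-hom , h-surj) with 𝕊Pfin⇒↪-^ A {C} C∈𝕊P
  ... | k , e , e-hom , e-injective =
    record
      { power   = k
      ; _∼_     = G
      ; _∼?_    = λ u b → Finite-any? (finite C) λ c →
                    Finite-≟ (finite (A ^ᴬ k)) (e c) u ×-dec Finite-≟ (finite B) (h c) b
      ; isCover = record
        { closed = λ f G-us-bs → let cs , es≡us , hs≡bs = lift G-us-bs in
            op C f cs ,
            trans (e-hom f cs) (cong (op (A ^ᴬ k) f) es≡us) ,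
            trans (h-hom f cs) (cong (op B f) hs≡bs)
        ; onto   = λ b → let c , hc≡b = h-surj b in e c , c , refl , hc≡b refl
        }
      } ,
    λ { (c , ec≡u , hc≡b) (c′ , ec′≡u , hc′≡b′) →
        trans (sym hc≡b) (trans (cong h (e-injective (trans ec≡u (sym ec′≡u)))) hc′≡b′) }
    where
    G : REL (Carrier (A ^ᴬ k)) (Carrier B) 0ℓ
    G u b = ∃[ c ] (e c ≡ u × h c ≡ b)
    lift : ∀ {n} {us : Vec _ n} {bs} → Pointwise G us bs → ∃[ cs ] (map e cs ≡ us × map h cs ≡ bs)
    lift []                         = [] , refl , refl
    lift ((c , refl , refl) ∷ rest) with lift rest
    ... | cs , refl , refl = c ∷ cs , refl , refl

  -- The graph itself is the subalgebra: its first projection is injective because the relation is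
  -- functional, and its second is the quotient map.
  cover⇒HSPfin : ∀ A B (𝒞 : Cover A B) → Functional (_∼_ 𝒞) → HSPfin A B
  cover⇒HSPfin A B 𝒞 functional =
    G , (A ^ᴬ k , (k , const A , (λ _ → refl) , id , id-hom (A ^ᴬ k) , id , λ y → y , id)
        , proj₁ ∘ proj₁ , (λ f xs → cong (op (A ^ᴬ k) f) (sym (map-∘ proj₁ proj₁ xs))) , injective)
      , proj₂ ∘ proj₁ , (λ f xs → cong (op B f) (sym (map-∘ proj₂ proj₁ xs))) , surjective
    where
    k = power 𝒞
    graph? : Decidable (uncurry (_∼_ 𝒞))
    graph? (u , b) = _∼?_ 𝒞 u b
    Graph : Set
    Graph = ∃[ ub ] True (graph? ub)
    components : ∀ {n} (xs : Vec Graph n) →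
      Pointwise (_∼_ 𝒞) (map proj₁ (map proj₁ xs)) (map proj₂ (map proj₁ xs))
    components []             = []
    components ((ub , t) ∷ xs) = toWitness t ∷ components xs
    G : FiniteAlgebra S
    G = record
      { algebra = record
        { Carrier = Graph
        ; op      = λ f xs → op (A ^ᴬ k ⊗ B) f (map proj₁ xs) , fromWitness (closed 𝒞 f (components xs))
        ; point   = let u , u∼b = onto 𝒞 (point B) in (u , point B) , fromWitness u∼b
        }
      ; finite = Finite-Σ-T (finite (A ^ᴬ k ⊗ B)) _
      }
    injective : ∀ {x y : Graph} → proj₁ (proj₁ x) ≡ proj₁ (proj₁ y) → x ≡ y
    injective {(u , b) , t} {(.u , b′) , t′} refl =
      Σ-True-≡ {P? = graph?} (cong (u ,_) (functional (toWitness t) (toWitness t′)))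
    surjective : ∀ b → ∃[ x ] (∀ {z : Graph} → z ≡ x → proj₂ (proj₁ z) ≡ b)
    surjective b = let u , u∼b = onto 𝒞 b in ((u , b) , fromWitness u∼b) , λ { refl → refl }

-- Deciding membership in the pseudovariety, and subdirect products

module _ {S : Signature} where

  open Cover using (power; _∼_; _∼?_; isCover; closed; onto)

  IsCover-resp-⇔ : ∀ (A B : FiniteAlgebra S) k {G G′ : REL (Carrier (A ^ᴬ k)) (Carrier B) 0ℓ} →
    (∀ {u b} → G u b → G′ u b) → (∀ {u b} → G′ u b → G u b) → IsCover A B k G → IsCover A B k G′
  IsCover-resp-⇔ A B k {G} {G′} G⇒G′ G′⇒G G-cover = record
    { closed = λ f G′-us-bs → G⇒G′ (IsCover.closed G-cover f (Pointwise.map G′⇒G G′-us-bs))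
    ; onto   = λ b → map₂ G⇒G′ (IsCover.onto G-cover b)
    }

  isCover? : Finite (Op S) → (A B : FiniteAlgebra S) → ∀ k {G : REL (Carrier (A ^ᴬ k)) (Carrier B) 0ℓ} →
    Decidable₂ G → Dec (IsCover A B k G)
  isCover? Op-finite A B k {G} G? = map′
    (λ (c , o) → record { closed = λ f G-us-bs → c f _ _ G-us-bs ; onto = o })
    (λ G-cover → (λ f us bs → IsCover.closed G-cover f) , IsCover.onto G-cover)
    ((Finite-all? Op-finite λ f →
      Finite-all? (Finite-Vec (finite (A ^ᴬ k)) (arity S f)) λ us →
      Finite-all? (Finite-Vec (finite B) (arity S f)) λ bs →
        Pointwise.decidable G? us bs →-dec G? (op (A ^ᴬ k) f us) (op B f bs))
    ×-dec
    (Finite-all? (finite B) λ b → Finite-any? (finite (A ^ᴬ k)) λ u → G? u b))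

  functional? : ∀ {X Y : Set} → Finite X → Finite Y → {G : REL X Y 0ℓ} →
    Decidable₂ G → Dec (Functional G)
  functional? X-finite Y-finite G? = map′
    (λ e {u} {b} {b′} → e u b b′) (λ e u b b′ → e)
    (Finite-all? X-finite λ u → Finite-all? Y-finite λ b → Finite-all? Y-finite λ b′ →
      G? u b →-dec (G? u b′ →-dec Finite-≟ Y-finite b b′))

  reindex-closed : (A B : FiniteAlgebra S) → ∀ {k l} (j : Fin k → Fin l)
    {G : REL (Carrier (A ^ᴬ k)) (Carrier B) 0ℓ} →
    (∀ f {us bs} → Pointwise G us bs → G (op (A ^ᴬ k) f us) (op B f bs)) →
    ∀ f {us bs} → Pointwise (G ∘ reindex A j) us bs → G (reindex A j (op (A ^ᴬ l) f us)) (op B f bs)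
  reindex-closed A B {k} {l} j {G} closed f G-us-bs =
    subst (λ u → G u _) (sym (reindex-hom A j f _))
      -- `map⁺` maps both vectors, so the second one acquires a `map id` that has to be removed.
      (closed f (subst (Pointwise G _) (map-id _) (Pointwise.map⁺ {g = id} id G-us-bs)))

  -- The new power has one coordinate per function B → A. Coordinate `i` of the old power is sent to
  -- the function `column i` that lists the `i`-th entries of the chosen preimages `u b`, and the
  -- cover is pulled back along this map, which keeps it functional.
  cover-boundedPower : (A B : FiniteAlgebra S) (𝒞 : Cover A B) → Functional (_∼_ 𝒞) →
    Σ[ 𝒟 ∈ Cover A B ] (Functional (_∼_ 𝒟) × power 𝒟 ≡ proj₁ (finite A) ^ proj₁ (finite B))
  cover-boundedPower A B 𝒞 functional = record
    { power   = proj₁ (finite A) ^ proj₁ (finite B)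
    ; _∼_     = λ u → _∼_ 𝒞 (reindex A column u)
    ; _∼?_    = λ u → _∼?_ 𝒞 (reindex A column u)
    ; isCover = record
      { closed = reindex-closed A B column (closed 𝒞)
      -- The preimage of `b` is evaluation at `b`; its `column i` entry is the `i`-th entry of
      -- `u b`.
      ; onto   = λ b → tuple (const A) (λ c → from A↔m (finToFun c (to B↔n b))) ,
          subst (λ u → _∼_ 𝒞 u b)
            (sym (reindex-tuple A column _ (u b) λ i → begin
              from A↔m (finToFun (column i) (to B↔n b)) ≡⟨ cong (from A↔m) (finToFun-funToFin _ (to B↔n b)) ⟩
              from A↔m (to A↔m (proj (const A) i (u (from B↔n (to B↔n b))))) ≡⟨ strictlyInverseʳ A↔m _ ⟩
              proj (const A) i (u (from B↔n (to B↔n b))) ≡⟨ cong (proj (const A) i ∘ u) (strictlyInverseʳ B↔n b) ⟩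
              proj (const A) i (u b) ∎))
            (proj₂ (onto 𝒞 b))
      }
    } , functional , refl
    where
    open ≡-Reasoning
    A↔m = proj₂ (finite A)
    B↔n = proj₂ (finite B)
    u : Carrier B → Carrier (A ^ᴬ power 𝒞)
    u b = proj₁ (onto 𝒞 b)
    column : Fin (power 𝒞) → Fin (proj₁ (finite A) ^ proj₁ (finite B))
    column i = funToFin (λ b → to A↔m (proj (const A) i (u (from B↔n b))))

  -- With the power fixed, a functional cover is one of finitely many subsets of `A ^ᴬ k ⊗ B`, and
  -- all of these can be tested.
  HSPfin? : Finite (Op S) → (A B : FiniteAlgebra S) → Dec (HSPfin A B)
  HSPfin? Op-finite A B = map′
    (λ (s , s-cover , s-functional) →
      cover⇒HSPfin A B (record { power = k ; _∼?_ = Graph? s ; isCover = s-cover }) s-functional)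
    complete
    (anySubset? λ s → isCover? Op-finite A B k (Graph? s) ×-dec functional? (finite (A ^ᴬ k)) (finite B) (Graph? s))
    where
    k = proj₁ (finite A) ^ proj₁ (finite B)
    open FiniteSubset (finite (A ^ᴬ k ⊗ B))
    Graph : Subset _ → REL (Carrier (A ^ᴬ k)) (Carrier B) 0ℓ
    Graph s u b = (u , b) ∈ˢ s
    Graph? : ∀ s → Decidable₂ (Graph s)
    Graph? s u b = (u , b) ∈ˢ? s
    complete : HSPfin A B → ∃[ s ] (IsCover A B k (Graph s) × Functional (Graph s))
    complete B∈K with uncurry (cover-boundedPower A B) (HSPfin⇒cover A B B∈K)
    ... | 𝒞 , functional , refl =
      comprehension graph? ,
      IsCover-resp-⇔ A B k (∈-comprehension⁺ graph?) (∈-comprehension⁻ graph?) (isCover 𝒞) ,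
      λ u∼b u∼b′ → functional (∈-comprehension⁻ graph? u∼b) (∈-comprehension⁻ graph? u∼b′)
      where
      graph? : Decidable (uncurry (_∼_ 𝒞))
      graph? (u , b) = _∼?_ 𝒞 u b

  -- Membership from separating homomorphisms

  module _ (A B : FiniteAlgebra S) where

    -- Call the elements of B related to one `u` a row. Every row of `𝒟` lies in a row of `𝒞`, so a
    -- restriction on pairs sharing a row passes from `𝒞` to `𝒟`.
    Refines : Cover A B → Cover A B → Set
    Refines 𝒟 𝒞 = ∀ u → ∃[ v ] (∀ b → _∼_ 𝒟 u b → _∼_ 𝒞 v b)

    ⊤-cover : Cover A B
    ⊤-cover = record
      { power   = 0
      ; _∼_     = λ _ _ → ⊤
      ; _∼?_    = λ _ _ → yes tt
      ; isCover = record { closed = λ _ _ → tt ; onto = λ _ → tt , tt }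
      }

    infixr 6 _∩ᶜ_

    _∩ᶜ_ : Cover A B → Cover A B → Cover A B
    𝒞 ∩ᶜ 𝒟 = record
      { power   = power 𝒞 + power 𝒟
      ; _∼_     = λ u b → _∼_ 𝒞 (reindex A left u) b × _∼_ 𝒟 (reindex A right u) b
      ; _∼?_    = λ u b → _∼?_ 𝒞 (reindex A left u) b ×-dec _∼?_ 𝒟 (reindex A right u) b
      ; isCover = record
        { closed = λ f us∼bs →
            reindex-closed A B left (closed 𝒞) f (Pointwise.map proj₁ us∼bs) ,
            reindex-closed A B right (closed 𝒟) f (Pointwise.map proj₂ us∼bs)
        ; onto   = λ b →
            let u , u∼b = onto 𝒞 b
                v , v∼b = onto 𝒟 b
                x = [ (λ i → proj (const A) i u) , (λ i → proj (const A) i v) ]′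
            in tuple (const A) (x ∘ splitAt (power 𝒞)) ,
               subst (λ w → _∼_ 𝒞 w b) (sym (reindex-tuple A left (x ∘ splitAt (power 𝒞)) u λ i → cong x (splitAt-↑ˡ (power 𝒞) i (power 𝒟)))) u∼b ,
               subst (λ w → _∼_ 𝒟 w b) (sym (reindex-tuple A right (x ∘ splitAt (power 𝒞)) v λ i → cong x (splitAt-↑ʳ (power 𝒞) (power 𝒟) i))) v∼b
        }
      }
      where
      left : Fin (power 𝒞) → Fin (power 𝒞 + power 𝒟)
      left = _↑ˡ power 𝒟
      right : Fin (power 𝒟) → Fin (power 𝒞 + power 𝒟)
      right = power 𝒞 ↑ʳ_

    Fin-common-refinement : ∀ {n} (𝒞 : Fin n → Cover A B) → Σ[ 𝒟 ∈ Cover A B ] (∀ i → Refines 𝒟 (𝒞 i))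
    Fin-common-refinement {zero}  𝒞 = ⊤-cover , λ ()
    Fin-common-refinement {suc n} 𝒞 =
      let 𝒟 , refines = Fin-common-refinement (𝒞 ∘ suc) in
      𝒞 zero ∩ᶜ 𝒟 , λ
        { zero    u → _ , λ _ → proj₁
        ; (suc i) u → let v , v-refines = refines i _ in v , λ b → v-refines b ∘ proj₂
        }

    common-refinement : ∀ {I : Set} → Finite I → (𝒞 : I → Cover A B) →
      Σ[ 𝒟 ∈ Cover A B ] (∀ i → Refines 𝒟 (𝒞 i))
    common-refinement (_ , I↔n) 𝒞 =
      let 𝒟 , refines = Fin-common-refinement (𝒞 ∘ from I↔n) in
      𝒟 , λ i → subst (Refines 𝒟 ∘ 𝒞) (strictlyInverseʳ I↔n i) (refines (to I↔n i))

    -- Each `h b` has a partner because `𝒞` covers all of L, so any homomorphism into L serves, onto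
    -- or not.
    comap-cover : (L : FiniteAlgebra S) (h : Carrier B → Carrier L) → IsHomomorphism B L h →
      Cover A L → Cover A B
    comap-cover L h h-hom 𝒞 = record
      { power   = power 𝒞
      ; _∼_     = λ u b → _∼_ 𝒞 u (h b)
      ; _∼?_    = λ u b → _∼?_ 𝒞 u (h b)
      ; isCover = record
        { closed = λ f us∼bs → subst (_∼_ 𝒞 _) (sym (h-hom f _))
            (closed 𝒞 f (subst (λ us → Pointwise (_∼_ 𝒞) us _) (map-id _) (Pointwise.map⁺ {f = id} id us∼bs)))
        ; onto   = onto 𝒞 ∘ h
        }
      }

    -- Each pair gets a cover in which no row contains both elements unless they are equal. In a
    -- common refinement over all pairs every row has at most one element, so it is functional. This
    -- replaces embedding B in a product of the algebras L.
    residual⇒HSPfin :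
      (∀ a b → a ≢ b → Σ[ L ∈ FiniteAlgebra S ] (HSPfin A L × Σ[ h ∈ _ ] (IsHomomorphism B L h × h a ≢ h b))) →
      HSPfin A B
    residual⇒HSPfin residual =
      let 𝒟 , refines = common-refinement (Finite-× (finite B) (finite B)) (λ (a , b) → proj₁ (separating a b))
      in cover⇒HSPfin A B 𝒟 λ {u} {a} {b} u∼a u∼b →
           let v , v-refines = refines (a , b) u
           in proj₂ (separating a b) (v-refines a u∼a) (v-refines b u∼b)
      where
      separating : ∀ a b → Σ[ 𝒞 ∈ Cover A B ] (∀ {u} → _∼_ 𝒞 u a → _∼_ 𝒞 u b → a ≡ b)
      separating a b with Finite-≟ (finite B) a b
      ... | yes a≡b = ⊤-cover , λ _ _ → a≡b
      ... | no  a≢b with residual a b a≢b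
      ...   | L , L∈K , h , h-hom , ha≢hb with HSPfin⇒cover A L L∈K
      ...     | 𝒞 , functional =
        comap-cover L h h-hom 𝒞 , λ u∼ha u∼hb → contradiction (functional u∼ha u∼hb) ha≢hb

-- Subdirectly irreducible quotients

module _ {S : Signature} where

  open IsCongruence
  open IsEquivalence using () renaming (refl to ≈-refl; sym to ≈-sym; trans to ≈-trans)

  Pointwise⇒≡-map : ∀ {X Y : Set} (q : X → Y) {n} {xs ys : Vec X n} →
    Pointwise (λ x y → q x ≡ q y) xs ys → map q xs ≡ map q ys
  Pointwise⇒≡-map q []         = refl
  Pointwise⇒≡-map q (eq ∷ eqs) = cong₂ _∷_ eq (Pointwise⇒≡-map q eqs)

  ≡-isCongruence : (A : FiniteAlgebra S) → IsCongruence A _≡_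
  ≡-isCongruence A = record
    { isEquivalence = ≡.isEquivalence
    ; compatible    = λ f xs≡ys → cong (op A f) (Pointwise.Pointwise-≡⇒≡ xs≡ys)
    }

  comap-isCongruence : (A B : FiniteAlgebra S) {h : Carrier A → Carrier B} → IsHomomorphism A B h →
    {θ : Rel (Carrier B) 0ℓ} → IsCongruence B θ → IsCongruence A (λ x y → θ (h x) (h y))
  comap-isCongruence A B {h} h-hom {θ} θ-cong = record
    { isEquivalence = record
      { refl  = ≈-refl (isEquivalence θ-cong)
      ; sym   = ≈-sym (isEquivalence θ-cong)
      ; trans = ≈-trans (isEquivalence θ-cong)
      }
    ; compatible = λ f {xs} {ys} xs∼ys →
        subst (λ z → θ z _) (sym (h-hom f xs))
          (subst (θ _) (sym (h-hom f ys)) (compatible θ-cong f (Pointwise.map⁺ id xs∼ys)))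
    }

  IsCongruence-resp-⇔ : (A : FiniteAlgebra S) {θ ψ : Rel (Carrier A) 0ℓ} →
    (∀ {x y} → θ x y → ψ x y) → (∀ {x y} → ψ x y → θ x y) → IsCongruence A θ → IsCongruence A ψ
  IsCongruence-resp-⇔ A θ⇒ψ ψ⇒θ θ-cong = record
    { isEquivalence = record
      { refl  = θ⇒ψ (≈-refl (isEquivalence θ-cong))
      ; sym   = θ⇒ψ ∘ ≈-sym (isEquivalence θ-cong) ∘ ψ⇒θ
      ; trans = λ x∼y y∼z → θ⇒ψ (≈-trans (isEquivalence θ-cong) (ψ⇒θ x∼y) (ψ⇒θ y∼z))
      }
    ; compatible = λ f xs∼ys → θ⇒ψ (compatible θ-cong f (Pointwise.map ψ⇒θ xs∼ys))
    }

  -- Membership in the congruence generated by `θ`, given impredicatively.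
  Forced : (A : FiniteAlgebra S) → Rel (Carrier A) 0ℓ → Carrier A → Carrier A → Set₁
  Forced A θ x y = ∀ ψ → IsCongruence A ψ → (∀ {x y} → θ x y → ψ x y) → ψ x y

  -- An instance of a congruence law that fails names a pair that is missing from `θ` but lies in
  -- every congruence above it. Adding such a pair is one step of generating a congruence.
  congruence-or-forced : Finite (Op S) → (A : FiniteAlgebra S) {θ : Rel (Carrier A) 0ℓ} →
    Decidable₂ θ → IsCongruence A θ ⊎ (∃[ x ] ∃[ y ] (¬ θ x y × Forced A θ x y))
  congruence-or-forced Op-finite A {θ} θ?
    with all-or-counterexample (finite A) (λ x → θ? x x)
  ... | inj₂ (x , ¬xx) = inj₂ (x , x , ¬xx , λ ψ ψ-cong θ⇒ψ → ≈-refl (isEquivalence ψ-cong))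
  ... | inj₁ reflexive
    with all-or-counterexample (Finite-× (finite A) (finite A)) (λ (x , y) → θ? x y →-dec θ? y x)
  ... | inj₂ ((x , y) , ¬sym) = inj₂
    (y , x , (λ yx → ¬sym λ _ → yx) , λ ψ ψ-cong θ⇒ψ →
      ≈-sym (isEquivalence ψ-cong)
        (θ⇒ψ (decidable-stable (θ? x y) λ ¬xy → ¬sym λ xy → contradiction xy ¬xy)))
  ... | inj₁ symmetric
    with all-or-counterexample (Finite-× (finite A) (Finite-× (finite A) (finite A)))
           (λ (x , y , z) → (θ? x y ×-dec θ? y z) →-dec θ? x z)
  ... | inj₂ ((x , y , z) , ¬trans) = inj₂
    (x , z , (λ xz → ¬trans λ _ → xz) , λ ψ ψ-cong θ⇒ψ →
      let xy , yz = decidable-stable (θ? x y ×-dec θ? y z)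
            (λ ¬xyz → ¬trans λ xyz → contradiction xyz ¬xyz)
      in ≈-trans (isEquivalence ψ-cong) (θ⇒ψ xy) (θ⇒ψ yz))
  ... | inj₁ transitive
    with all-or-counterexample Op-finite (λ f →
           Finite-all? (Finite-Vec (finite A) (arity S f)) λ xs →
           Finite-all? (Finite-Vec (finite A) (arity S f)) λ ys →
             Pointwise.decidable θ? xs ys →-dec θ? (op A f xs) (op A f ys))
  ... | inj₁ compat = inj₁ record
    { isEquivalence = record
      { refl  = reflexive _
      ; sym   = symmetric _
      ; trans = λ xy yz → transitive _ (xy , yz)
      }
    ; compatible = λ f → compat f _ _
    }
  ... | inj₂ (f , ¬compat)
    -- So far only the operation `f` is known to fail; a second search finds the arguments.
    with all-or-counterexample (Finite-× (Finite-Vec (finite A) (arity S f)) (Finite-Vec (finite A) (arity S f)))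
           (λ (xs , ys) → Pointwise.decidable θ? xs ys →-dec θ? (op A f xs) (op A f ys))
  ... | inj₁ compat = contradiction (λ xs ys → compat (xs , ys)) ¬compat
  ... | inj₂ ((xs , ys) , ¬compat′) = inj₂
    (op A f xs , op A f ys , (λ fxfy → ¬compat′ λ _ → fxfy) , λ ψ ψ-cong θ⇒ψ →
      compatible ψ-cong f (Pointwise.map θ⇒ψ
        (decidable-stable (Pointwise.decidable θ? xs ys)
          λ ¬xs∼ys → ¬compat′ λ xs∼ys → contradiction xs∼ys ¬xs∼ys)))

  isCongruence? : Finite (Op S) → (A : FiniteAlgebra S) {θ : Rel (Carrier A) 0ℓ} →
    Decidable₂ θ → Dec (IsCongruence A θ)
  isCongruence? Op-finite A {θ} θ? with congruence-or-forced Op-finite A θ?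
  ... | inj₁ θ-cong                   = yes θ-cong
  ... | inj₂ (_ , _ , ¬xy , xy-forced) = no λ θ-cong → ¬xy (xy-forced θ θ-cong id)

  -- Classes are subsets stored as bit vectors, so related elements have equal classes. A
  -- representative is found by search from the class alone.
  quotient : (B : FiniteAlgebra S) {θ : Rel (Carrier B) 0ℓ} → Decidable₂ θ → IsCongruence B θ →
    Σ[ Q ∈ FiniteAlgebra S ] Σ[ (q , _) ∈ B ↠ Q ]
      ((∀ {x y} → θ x y → q x ≡ q y) × (∀ {x y} → q x ≡ q y → θ x y))
  quotient B {θ} θ? θ-cong =
    Q , (q , q-hom , λ i → rep i , λ { refl → Σ-True-≡ {P? = class?} (rep-class i) }) ,
    θ⇒≡ , ≡⇒θ
    where
    open FiniteSubset (finite B)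
    class : Carrier B → Subset _
    class x = comprehension (θ? x)
    class? : Decidable (λ s → ∃[ x ] class x ≡ s)
    class? s = Finite-any? (finite B) λ x → Finite-≟ (Finite-Subset _) (class x) s
    Q-Carrier : Set
    Q-Carrier = ∃[ s ] True (class? s)
    q : Carrier B → Q-Carrier
    q x = class x , fromWitness (x , refl)
    rep : Q-Carrier → Carrier B
    rep (s , t) = proj₁ (toWitness t)
    rep-class : ∀ i → class (rep i) ≡ proj₁ i
    rep-class (s , t) = proj₂ (toWitness t)
    θ⇒≡ : ∀ {x y} → θ x y → q x ≡ q y
    θ⇒≡ {x} {y} xy = Σ-True-≡ {P? = class?} (∈ˢ-ext
      (λ z z∈ → ∈-comprehension⁺ (θ? y) (≈-trans E (≈-sym E xy) (∈-comprehension⁻ (θ? x) z∈)))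
      (λ z z∈ → ∈-comprehension⁺ (θ? x) (≈-trans E xy (∈-comprehension⁻ (θ? y) z∈))))
      where E = isEquivalence θ-cong
    ≡⇒θ : ∀ {x y} → q x ≡ q y → θ x y
    ≡⇒θ {x} {y} eq = ∈-comprehension⁻ (θ? x)
      (subst (y ∈ˢ_) (sym (cong proj₁ eq)) (∈-comprehension⁺ (θ? y) (≈-refl (isEquivalence θ-cong))))
    Q : FiniteAlgebra S
    Q = record
      { algebra = record
        { Carrier = Q-Carrier
        ; op      = λ f is → q (op B f (map rep is))
        ; point   = q (point B)
        }
      ; finite  = Finite-Σ-T (Finite-Subset _) _
      }
    rep-q : ∀ {n} (xs : Vec (Carrier B) n) → Pointwise θ xs (map rep (map q xs))
    rep-q []       = []
    rep-q (x ∷ xs) = ≡⇒θ (sym (Σ-True-≡ {P? = class?} (rep-class (q x)))) ∷ rep-q xs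
    q-hom : IsHomomorphism B Q q
    q-hom f xs = θ⇒≡ (compatible θ-cong f (rep-q xs))

  -- Congruences as subsets of the type of pairs

  module DecidableCongruence (Op-finite : Finite (Op S)) (A : FiniteAlgebra S) where

    open FiniteSubset (finite (A ⊗ A)) public

    Graph : Subset (proj₁ (finite (A ⊗ A))) → Rel (Carrier A) 0ℓ
    Graph s x y = (x , y) ∈ˢ s

    Graph? : ∀ s → Decidable₂ (Graph s)
    Graph? s x y = (x , y) ∈ˢ? s

    graph : {θ : Rel (Carrier A) 0ℓ} → Decidable₂ θ → Subset (proj₁ (finite (A ⊗ A)))
    graph θ? = comprehension (uncurry θ?)

    graph-isCongruence : {θ : Rel (Carrier A) 0ℓ} (θ? : Decidable₂ θ) →
      IsCongruence A θ → IsCongruence A (Graph (graph θ?))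
    graph-isCongruence θ? =
      IsCongruence-resp-⇔ A (∈-comprehension⁺ (uncurry θ?)) (∈-comprehension⁻ (uncurry θ?))

    pair : Carrier A → Carrier A → Fin (proj₁ (finite (A ⊗ A)))
    pair x y = to (proj₂ (finite (A ⊗ A))) (x , y)

    Graph-⁅⁆ : ∀ {x y} → ∀ {z w} → Graph ⁅ pair x y ⁆ z w → (z , w) ≡ (x , y)
    Graph-⁅⁆ {x} {y} {z} {w} zw = begin
      z , w                     ≡⟨ strictlyInverseʳ e _ ⟨
      from e (to e (z , w))     ≡⟨ cong (from e) (x∈⁅y⁆⇒x≡y _ zw) ⟩
      from e (to e (x , y))     ≡⟨ strictlyInverseʳ e _ ⟩
      x , y                     ∎
      where
      open ≡-Reasoning
      e = proj₂ (finite (A ⊗ A))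

    -- `ψ` may be undecidable. Starting from the single pair, forced pairs are added; they stay
    -- within `ψ`, and the growth ends at a congruence.
    decidable-subcongruence : {ψ : Rel (Carrier A) 0ℓ} → IsCongruence A ψ → ∀ {c d} → ψ c d →
      ∃[ s ] (IsCongruence A (Graph s) × Graph s c d × (∀ {x y} → Graph s x y → ψ x y))
    decidable-subcongruence {ψ} ψ-cong {c} {d} cd =
      let s , (cd∈s , s⇒ψ) , s-cong = ascend step ⁅ pair c d ⁆
            (x∈⁅x⁆ _ , λ xy → subst (uncurry ψ) (sym (Graph-⁅⁆ xy)) cd)
      in s , s-cong , cd∈s , s⇒ψ
      where
      Below : Subset _ → Set
      Below s = Graph s c d × (∀ {x y} → Graph s x y → ψ x y)
      step : ∀ s → Below s → IsCongruence A (Graph s) ⊎ (∃[ t ] (s ⊂ t × Below t))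
      step s (cd∈s , s⇒ψ) with congruence-or-forced Op-finite A (Graph? s)
      ... | inj₁ s-cong = inj₁ s-cong
      ... | inj₂ (x , y , ¬xy , xy-forced) = inj₂
        ( s ∪ ⁅ pair x y ⁆
        , (p⊆p∪q _ , pair x y , x∈p∪q⁺ (inj₂ (x∈⁅x⁆ _)) , ¬xy)
        , p⊆p∪q _ cd∈s
        , λ zw → [ s⇒ψ , (λ zw∈ → subst (uncurry ψ) (sym (Graph-⁅⁆ zw∈)) (xy-forced ψ ψ-cong s⇒ψ)) ]′
                   (x∈p∪q⁻ s _ zw) )

    maximal-congruence-avoiding : ∀ {a b} → a ≢ b →
      ∃[ s ] ((IsCongruence A (Graph s) × ¬ Graph s a b) ×
              (∀ t → IsCongruence A (Graph t) → s ⊂ t → Graph t a b))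
    maximal-congruence-avoiding {a} {b} a≢b = ascend step (graph (Finite-≟ (finite A)))
      ( graph-isCongruence (Finite-≟ (finite A)) (≡-isCongruence A)
      , a≢b ∘ ∈-comprehension⁻ (uncurry (Finite-≟ (finite A))) )
      where
      Avoids : Subset _ → Set
      Avoids s = IsCongruence A (Graph s) × ¬ Graph s a b
      step : ∀ s → Avoids s →
        (∀ t → IsCongruence A (Graph t) → s ⊂ t → Graph t a b) ⊎ (∃[ t ] (s ⊂ t × Avoids t))
      step s _ with anySubset? (λ t → s ⊂? t ×-dec (isCongruence? Op-finite A (Graph? t) ×-dec ¬? (Graph? t a b)))
      ... | yes larger = inj₂ larger
      ... | no ¬larger = inj₁ λ t t-cong s⊂t →
        decidable-stable (Graph? t a b) λ ¬ab → ¬larger (t , s⊂t , t-cong , ¬ab)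

    -- The monolith is the intersection of the nontrivial congruences given by subsets; intersecting
    -- all congruences would leave `Set`. It is still below any nontrivial `ψ`, which contains a
    -- nontrivial congruence of this kind by `decidable-subcongruence`.
    decidable-minimum⇒subdirectlyIrreducible : ∀ {a b} → a ≢ b →
      (∀ t → IsCongruence A (Graph t) → Nontrivial A (Graph t) → Graph t a b) →
      SubdirectlyIrreducible A
    decidable-minimum⇒subdirectlyIrreducible {a} {b} a≢b ab-minimal =
      monolith , monolith-cong , (a , b , a≢b , ab-minimal) , minimum
      where
      monolith : Rel (Carrier A) 0ℓ
      monolith x y = ∀ t → IsCongruence A (Graph t) → Nontrivial A (Graph t) → Graph t x y
      monolith-cong : IsCongruence A monolith
      monolith-cong = record
        { isEquivalence = record
          { refl  = λ t t-cong _ → ≈-refl (isEquivalence t-cong)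
          ; sym   = λ xy t t-cong t-non → ≈-sym (isEquivalence t-cong) (xy t t-cong t-non)
          ; trans = λ xy yz t t-cong t-non →
              ≈-trans (isEquivalence t-cong) (xy t t-cong t-non) (yz t t-cong t-non)
          }
        ; compatible = λ f xs∼ys t t-cong t-non →
            compatible t-cong f (Pointwise.map (λ xy → xy t t-cong t-non) xs∼ys)
        }
      minimum : ∀ ψ → IsCongruence A ψ → Nontrivial A ψ → monolith ⇒ ψ
      minimum ψ ψ-cong (c , d , c≢d , cd) xy =
        let t , t-cong , cd∈t , t⇒ψ = decidable-subcongruence ψ-cong cd
        in t⇒ψ (xy t t-cong (c , d , c≢d , cd∈t))

  -- Birkhoff's argument: divide by a congruence maximal among those that omit (a, b). A nontrivial
  -- congruence of the quotient pulls back to a strictly larger one, which therefore contains (a,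
  -- b).
  subdirectlyIrreducible-quotient : Finite (Op S) → (B : FiniteAlgebra S) → ∀ {a b} → a ≢ b →
    Σ[ Q ∈ FiniteAlgebra S ] (SubdirectlyIrreducible Q × Σ[ (q , _) ∈ B ↠ Q ] q a ≢ q b)
  subdirectlyIrreducible-quotient Op-finite B {a} {b} a≢b
    with DecidableCongruence.maximal-congruence-avoiding Op-finite B a≢b
  ... | θ , (θ-cong , ¬ab) , θ-maximal
    with quotient B (DecidableCongruence.Graph? Op-finite B θ) θ-cong
  ... | Q , (q , q-hom , q-surj) , θ⇒≡ , ≡⇒θ =
    Q , DQ.decidable-minimum⇒subdirectlyIrreducible (¬ab ∘ ≡⇒θ) minimal , (q , q-hom , q-surj) , ¬ab ∘ ≡⇒θ
    where
    module DB = DecidableCongruence Op-finite B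
    module DQ = DecidableCongruence Op-finite Q
    minimal : ∀ t → IsCongruence Q (DQ.Graph t) → Nontrivial Q (DQ.Graph t) → DQ.Graph t (q a) (q b)
    minimal t t-cong (c , d , c≢d , cd) =
      DB.∈-comprehension⁻ (uncurry ψ?) (θ-maximal (DB.graph ψ?)
        (DB.graph-isCongruence ψ? ψ-cong)
        (θ⊆ψ , DB.pair (proj₁ (q-surj c)) (proj₁ (q-surj d)) ,
          DB.∈-comprehension⁺ (uncurry ψ?) ψ-cd , ¬θ-cd))
      where
      ψ : Rel (Carrier B) 0ℓ
      ψ x y = DQ.Graph t (q x) (q y)
      ψ? : Decidable₂ ψ
      ψ? x y = DQ.Graph? t (q x) (q y)
      ψ-cong : IsCongruence B ψ
      ψ-cong = comap-isCongruence B Q q-hom t-cong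
      qc≡c = proj₂ (q-surj c) refl
      qd≡d = proj₂ (q-surj d) refl
      ψ-cd : ψ (proj₁ (q-surj c)) (proj₁ (q-surj d))
      ψ-cd = subst (λ z → DQ.Graph t z _) (sym qc≡c) (subst (DQ.Graph t c) (sym qd≡d) cd)
      ¬θ-cd : ¬ DB.Graph θ (proj₁ (q-surj c)) (proj₁ (q-surj d))
      ¬θ-cd θ-cd = c≢d (trans (sym qc≡c) (trans (θ⇒≡ θ-cd) qd≡d))
      ψ⊇θ : ∀ z → z DB.∈ˢ θ → z DB.∈ˢ DB.graph ψ?
      ψ⊇θ (x , y) xy = DB.∈-comprehension⁺ (uncurry ψ?)
        (subst (DQ.Graph t (q x)) (θ⇒≡ xy) (≈-refl (isEquivalence t-cong)))
      θ⊆ψ : ∀ {i} → i ∈ θ → i ∈ DB.graph ψ?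
      θ⊆ψ = DB.∈ˢ⇒⊆ ψ⊇θ

-- Splitting environments at a block of quantifiers

prefix : ∀ {X : Set} k {n} → Vec X (k + n) → Vec X k
prefix k {n} xs = tabulate λ i → lookup xs (i ↑ˡ n)

suffix : ∀ {X : Set} k {n} → Vec X (k + n) → Vec X n
suffix k xs = tabulate λ i → lookup xs (k ↑ʳ i)

prefix-++ : ∀ {X : Set} {k n} (xs : Vec X k) (ys : Vec X n) → prefix k (xs ++ ys) ≡ xs
prefix-++ xs ys = trans (tabulate-cong (lookup-++ˡ xs ys)) (tabulate∘lookup xs)

suffix-++ : ∀ {X : Set} {k n} (xs : Vec X k) (ys : Vec X n) → suffix k (xs ++ ys) ≡ ys
suffix-++ xs ys = trans (tabulate-cong (lookup-++ʳ xs ys)) (tabulate∘lookup ys)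

Π-cong-⇔ : ∀ {X : Set} {P Q : X → Set} → (∀ x → P x ⇔ Q x) → (∀ x → P x) ⇔ (∀ x → Q x)
Π-cong-⇔ P⇔Q = mk⇔ (λ p x → to⇔ (P⇔Q x) (p x)) (λ q x → from⇔ (P⇔Q x) (q x))

∃-cong-⇔ : ∀ {X : Set} {P Q : X → Set} → (∀ x → P x ⇔ Q x) → ∃ P ⇔ ∃ Q
∃-cong-⇔ P⇔Q = mk⇔ (λ (x , p) → x , to⇔ (P⇔Q x) p) (λ (x , q) → x , from⇔ (P⇔Q x) q)

-- Definable properties

module _ {S : Signature} where

  ⊤′ : ∀ {n} → Formula S n
  ⊤′ = ⊥′ ⇒′ ⊥′

  ⋀ ⋁ : ∀ {k n} → (Fin k → Formula S n) → Formula S n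
  ⋀ {zero}  φ = ⊤′
  ⋀ {suc k} φ = φ zero ∧′ ⋀ (φ ∘ suc)
  ⋁ {zero}  φ = ⊥′
  ⋁ {suc k} φ = φ zero ∨′ ⋁ (φ ∘ suc)

  -- The innermost quantifier is added first, because `suc k + n` reduces to `suc (k + n)`; it binds
  -- the head of the vector.
  ∀^ ∃^ : ∀ k {n} → Formula S (k + n) → Formula S n
  ∀^ zero    φ = φ
  ∀^ (suc k) φ = ∀^ k (∀′ φ)
  ∃^ zero    φ = φ
  ∃^ (suc k) φ = ∃^ k (∃′ φ)

  module _ (B : FiniteAlgebra S) {n} (ρ : Vec (Carrier B) n) where

    Holds-⋀ : ∀ {k} (φ : Fin k → Formula S n) → Holds B ρ (⋀ φ) ⇔ (∀ i → Holds B ρ (φ i))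
    Holds-⋀ {zero}  φ = mk⇔ (λ _ ()) (λ _ ())
    Holds-⋀ {suc k} φ = mk⇔
      (λ { (h , hs) zero → h ; (h , hs) (suc i) → to⇔ (Holds-⋀ (φ ∘ suc)) hs i })
      (λ hs → hs zero , from⇔ (Holds-⋀ (φ ∘ suc)) (hs ∘ suc))

    Holds-⋁ : ∀ {k} (φ : Fin k → Formula S n) → Holds B ρ (⋁ φ) ⇔ (∃[ i ] Holds B ρ (φ i))
    Holds-⋁ {zero}  φ = mk⇔ (λ ()) (λ ())
    Holds-⋁ {suc k} φ = mk⇔
      (λ { (inj₁ h) → zero , h ; (inj₂ hs) → let i , h = to⇔ (Holds-⋁ (φ ∘ suc)) hs in suc i , h })
      (λ { (zero , h) → inj₁ h ; (suc i , h) → inj₂ (from⇔ (Holds-⋁ (φ ∘ suc)) (i , h)) })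

    Holds-∀^ : ∀ k (φ : Formula S (k + n)) → Holds B ρ (∀^ k φ) ⇔ (∀ xs → Holds B (xs ++ ρ) φ)
    Holds-∀^ zero    φ = mk⇔ (λ { h [] → h }) (λ h → h [])
    Holds-∀^ (suc k) φ = mk⇔
      (λ { h (x ∷ xs) → to⇔ (Holds-∀^ k (∀′ φ)) h xs x })
      (λ h → from⇔ (Holds-∀^ k (∀′ φ)) λ xs x → h (x ∷ xs))

    Holds-∃^ : ∀ k (φ : Formula S (k + n)) → Holds B ρ (∃^ k φ) ⇔ (∃[ xs ] Holds B (xs ++ ρ) φ)
    Holds-∃^ zero    φ = mk⇔ (λ h → [] , h) (λ { ([] , h) → h })
    Holds-∃^ (suc k) φ = mk⇔
      (λ h → let xs , x , h′ = to⇔ (Holds-∃^ k (∃′ φ)) h in x ∷ xs , h′)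
      (λ { (x ∷ xs , h) → from⇔ (Holds-∃^ k (∃′ φ)) (xs , x , h) })

    evals-tabulate : ∀ {k} (t : Fin k → Term S n) → evals B ρ (tabulate t) ≡ tabulate (eval B ρ ∘ t)
    evals-tabulate {zero}  t = refl
    evals-tabulate {suc k} t = cong (eval B ρ (t zero) ∷_) (evals-tabulate (t ∘ suc))

  ElementFamily : ℕ → Set₁
  ElementFamily n = (B : FiniteAlgebra S) → Vec (Carrier B) n → Carrier B

  Property : ℕ → Set₁
  Property n = (B : FiniteAlgebra S) → Vec (Carrier B) n → Set

  record DefinableElement {n} (e : ElementFamily n) : Set₁ where
    field
      term    : Term S n
      correct : ∀ B ρ → eval B ρ term ≡ e B ρ

  -- One formula for all finite B at once. The combinators below follow the shape of the property,
  -- so the final sentence is obtained from its meaning.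
  record Definable {n} (P : Property n) : Set₁ where
    field
      formula : Formula S n
      correct : ∀ B ρ → Holds B ρ formula ⇔ P B ρ

  open DefinableElement
  open Definable

  variableᵈ : ∀ {n} {e : ElementFamily n} (i : Fin n) →
    (∀ B ρ → lookup ρ i ≡ e B ρ) → DefinableElement e
  variableᵈ i eq = record { term = var i ; correct = eq }

  opᵈ : ∀ {n} f {es : (B : FiniteAlgebra S) → Vec (Carrier B) n → Vec (Carrier B) (arity S f)} →
    (∀ i → DefinableElement (λ B ρ → lookup (es B ρ) i)) →
    DefinableElement (λ B ρ → op B f (es B ρ))
  opᵈ f {es} ds = record
    { term    = app f (tabulate (term ∘ ds))
    ; correct = λ B ρ → cong (op B f) (trans (evals-tabulate B ρ (term ∘ ds))
        (trans (tabulate-cong (λ i → correct (ds i) B ρ)) (tabulate∘lookup (es B ρ))))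
    }

  infix  7 _≐ᵈ_
  infixr 6 _∧ᵈ_
  infixr 5 _∨ᵈ_
  infixr 4 _⇒ᵈ_ _⇔ᵈ_

  _≐ᵈ_ : ∀ {n} {d e : ElementFamily n} → DefinableElement d → DefinableElement e →
    Definable (λ B ρ → d B ρ ≡ e B ρ)
  s ≐ᵈ t = record
    { formula = term s ≐ term t
    ; correct = λ B ρ → mk⇔
        (λ eq → trans (sym (correct s B ρ)) (trans eq (correct t B ρ)))
        (λ eq → trans (correct s B ρ) (trans eq (sym (correct t B ρ))))
    }

  -- Facts about the fixed algebra L are decided outside the logic and enter formulas as truth
  -- values.
  constantᵈ : ∀ {n} {Q : Set} → Dec Q → Definable {n} (λ _ _ → Q)
  constantᵈ (yes q) = record { formula = ⊤′ ; correct = λ _ _ → mk⇔ (λ _ → q) (λ _ ()) }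
  constantᵈ (no ¬q) = record { formula = ⊥′ ; correct = λ _ _ → mk⇔ (λ ()) (λ q → contradiction q ¬q) }

  _∧ᵈ_ : ∀ {n} {P Q : Property n} → Definable P → Definable Q → Definable (λ B ρ → P B ρ × Q B ρ)
  φ ∧ᵈ ψ = record
    { formula = formula φ ∧′ formula ψ
    ; correct = λ B ρ → correct φ B ρ ×-⇔ correct ψ B ρ
    }

  _∨ᵈ_ : ∀ {n} {P Q : Property n} → Definable P → Definable Q → Definable (λ B ρ → P B ρ ⊎ Q B ρ)
  φ ∨ᵈ ψ = record
    { formula = formula φ ∨′ formula ψ
    ; correct = λ B ρ → correct φ B ρ ⊎-⇔ correct ψ B ρ
    }

  _⇒ᵈ_ : ∀ {n} {P Q : Property n} → Definable P → Definable Q → Definable (λ B ρ → P B ρ → Q B ρ)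
  φ ⇒ᵈ ψ = record
    { formula = formula φ ⇒′ formula ψ
    ; correct = λ B ρ → →-cong-⇔ (correct φ B ρ) (correct ψ B ρ)
    }

  _⇔ᵈ_ : ∀ {n} {P Q : Property n} → Definable P → Definable Q → Definable (λ B ρ → P B ρ ⇔ Q B ρ)
  φ ⇔ᵈ ψ = record
    { formula = (formula φ ⇒′ formula ψ) ∧′ (formula ψ ⇒′ formula φ)
    ; correct = λ B ρ →
        mk⇔ (λ (p , q) → mk⇔ p q) (λ e → to⇔ e , from⇔ e) ⇔-∘
        (→-cong-⇔ (correct φ B ρ) (correct ψ B ρ) ×-⇔ →-cong-⇔ (correct ψ B ρ) (correct φ B ρ))
    }

  ¬ᵈ_ : ∀ {n} {P : Property n} → Definable P → Definable (λ B ρ → ¬ P B ρ)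
  ¬ᵈ φ = record
    { formula = formula φ ⇒′ ⊥′
    ; correct = λ B ρ → →-cong-⇔ (correct φ B ρ) (⇔-id _)
    }

  ⋀ᵈ : ∀ {I : Set} → Finite I → ∀ {n} {P : I → Property n} →
    (∀ i → Definable (P i)) → Definable (λ B ρ → ∀ i → P i B ρ)
  ⋀ᵈ (_ , I↔k) {P = P} φ = record
    { formula = ⋀ (formula ∘ φ ∘ from I↔k)
    ; correct = λ B ρ → mk⇔
        (λ h i → subst (λ j → P j B ρ) (strictlyInverseʳ I↔k i)
          (to⇔ (correct (φ _) B ρ) (to⇔ (Holds-⋀ B ρ _) h (to I↔k i))))
        (λ p → from⇔ (Holds-⋀ B ρ _) λ j → from⇔ (correct (φ _) B ρ) (p _))
    }

  ⋁ᵈ : ∀ {I : Set} → Finite I → ∀ {n} {P : I → Property n} →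
    (∀ i → Definable (P i)) → Definable (λ B ρ → ∃[ i ] P i B ρ)
  ⋁ᵈ (_ , I↔k) {P = P} φ = record
    { formula = ⋁ (formula ∘ φ ∘ from I↔k)
    ; correct = λ B ρ → mk⇔
        (λ h → let j , hⱼ = to⇔ (Holds-⋁ B ρ _) h in from I↔k j , to⇔ (correct (φ _) B ρ) hⱼ)
        (λ (i , p) → from⇔ (Holds-⋁ B ρ _)
          (to I↔k i , from⇔ (correct (φ _) B ρ) (subst (λ j → P j B ρ) (sym (strictlyInverseʳ I↔k i)) p)))
    }

  ∀ᵈ : ∀ {n} {P : (B : FiniteAlgebra S) → Carrier B → Vec (Carrier B) n → Set} →
    Definable (λ B ρ → P B (head ρ) (tail ρ)) → Definable (λ B ρ → ∀ x → P B x ρ)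
  ∀ᵈ φ = record
    { formula = ∀′ (formula φ)
    ; correct = λ B ρ → Π-cong-⇔ λ x → correct φ B (x ∷ ρ)
    }

  module _ k {n} {P : (B : FiniteAlgebra S) → Vec (Carrier B) k → Vec (Carrier B) n → Set}
    (φ : Definable (λ B ρ → P B (prefix k ρ) (suffix k ρ))) where

    private
      body-correct : ∀ B xs ρ → Holds B (xs ++ ρ) (formula φ) ⇔ P B xs ρ
      body-correct B xs ρ =
        subst (_ ⇔_) (cong₂ (P B) (prefix-++ xs ρ) (suffix-++ xs ρ)) (correct φ B (xs ++ ρ))

    ∀ᵈ^ : Definable (λ B ρ → ∀ xs → P B xs ρ)
    ∀ᵈ^ = record
      { formula = ∀^ k (formula φ)
      ; correct = λ B ρ → Π-cong-⇔ (λ xs → body-correct B xs ρ) ⇔-∘ Holds-∀^ B ρ k (formula φ)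
      }

    ∃ᵈ^ : Definable (λ B ρ → ∃[ xs ] P B xs ρ)
    ∃ᵈ^ = record
      { formula = ∃^ k (formula φ)
      ; correct = λ B ρ → ∃-cong-⇔ (λ xs → body-correct B xs ρ) ⇔-∘ Holds-∃^ B ρ k (formula φ)
      }

  -- The meet operation and its order

  module Meet (m : Op S) (binary : arity S m ≡ 2) where

    meet : (B : FiniteAlgebra S) → Carrier B → Carrier B → Carrier B
    meet B x y = op B m (subst (Vec (Carrier B)) (sym binary) (x ∷ y ∷ []))

    private
      -- `arity S m` is not a variable, so `binary` cannot be matched; the arity is generalised to
      -- `k` here and in the next two lemmas.
      map-subst : ∀ {X Y : Set} {k} (eq : 2 ≡ k) (h : X → Y) x y →
        map h (subst (Vec X) eq (x ∷ y ∷ [])) ≡ subst (Vec Y) eq (h x ∷ h y ∷ [])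
      map-subst refl h x y = refl

      Pointwise-subst : ∀ {X Y : Set} {k} (eq : 2 ≡ k) {R : REL X Y 0ℓ} {x y x′ y′} → R x x′ → R y y′ →
        Pointwise R (subst (Vec X) eq (x ∷ y ∷ [])) (subst (Vec Y) eq (x′ ∷ y′ ∷ []))
      Pointwise-subst refl xx′ yy′ = xx′ ∷ yy′ ∷ []

      evals-subst : ∀ {n k} (eq : 2 ≡ k) (B : FiniteAlgebra S) (ρ : Vec (Carrier B) n) s t →
        evals B ρ (subst (Vec (Term S n)) eq (s ∷ t ∷ [])) ≡
        subst (Vec (Carrier B)) eq (eval B ρ s ∷ eval B ρ t ∷ [])
      evals-subst refl B ρ s t = refl

    meetᵈ : ∀ {n} {d e : ElementFamily n} → DefinableElement d → DefinableElement e →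
      DefinableElement (λ B ρ → meet B (d B ρ) (e B ρ))
    meetᵈ s t = record
      { term    = app m (subst (Vec (Term S _)) (sym binary) (term s ∷ term t ∷ []))
      ; correct = λ B ρ → trans
          (cong (op B m) (evals-subst (sym binary) B ρ (term s) (term t)))
          (cong₂ (meet B) (correct s B ρ) (correct t B ρ))
      }

    meet-hom : (B C : FiniteAlgebra S) {h : Carrier B → Carrier C} → IsHomomorphism B C h →
      ∀ x y → h (meet B x y) ≡ meet C (h x) (h y)
    meet-hom B C {h} h-hom x y = trans (h-hom m _) (cong (op C m) (map-subst (sym binary) h x y))

    Semilattice : FiniteAlgebra S → Set
    Semilattice B = IsSemilattice _≡_ (meet B)

    module Laws {B : FiniteAlgebra S} (B-semi : Semilattice B) = IsSemilattice _≡_ {meet B} B-semi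
    open Laws using (idem; comm; assoc; isSemigroup)

    private
      laws⇒semilattice : ∀ B → Associative _≡_ (meet B) → Idempotent _≡_ (meet B) → Commutative _≡_ (meet B) →
        Semilattice B
      laws⇒semilattice B assoc idem comm = record
        { isBand = record
          { isSemigroup = record
            { isMagma = record { isEquivalence = ≡.isEquivalence ; ∙-cong = cong₂ (meet B) }
            ; assoc   = assoc
            }
          ; idem = idem
          }
        ; comm = comm
        }

    ^-semilattice : ∀ A k → Semilattice A → Semilattice (A ^ᴬ k)
    ^-semilattice A k A-semi = laws⇒semilattice (A ^ᴬ k)
      (λ x y z → proj-ext (const A) λ i → begin
        π i (x ∙ y ∙ z)               ≡⟨ trans (π-∙ i _ z) (cong (λ a → meet A a (π i z)) (π-∙ i x y)) ⟩
        meet A (meet A (π i x) (π i y)) (π i z) ≡⟨ assoc {A} A-semi _ _ _ ⟩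
        meet A (π i x) (meet A (π i y) (π i z)) ≡⟨ trans (π-∙ i x _) (cong (meet A (π i x)) (π-∙ i y z)) ⟨
        π i (x ∙ (y ∙ z))             ∎)
      (λ x → proj-ext (const A) λ i → trans (π-∙ i x x) (idem {A} A-semi (π i x)))
      (λ x y → proj-ext (const A) λ i →
        trans (π-∙ i x y) (trans (comm {A} A-semi (π i x) (π i y)) (sym (π-∙ i y x))))
      where
      open ≡-Reasoning
      infixl 7 _∙_
      _∙_ = meet (A ^ᴬ k)
      π : Fin k → Carrier (A ^ᴬ k) → Carrier A
      π = proj (const A)
      π-∙ : ∀ i x y → π i (x ∙ y) ≡ meet A (π i x) (π i y)
      π-∙ i = meet-hom (A ^ᴬ k) A (proj-hom (const A) i)

    -- Both sides of a law are related to the corresponding terms in the power of A. These agree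
    -- there, and functionality carries the equality to B.
    HSPfin⇒semilattice : ∀ A B → Semilattice A → HSPfin A B → Semilattice B
    HSPfin⇒semilattice A B A-semi B∈K = laws⇒semilattice B
      (λ x y z → let u , ux = onto x ; v , vy = onto y ; w , wz = onto z in
        functional (∙-closed (∙-closed ux vy) wz)
          (subst (_∼ _) (sym (assoc {A ^ᴬ power} A^k-semi u v w)) (∙-closed ux (∙-closed vy wz))))
      (λ x → let u , ux = onto x in
        functional (∙-closed ux ux) (subst (_∼ _) (sym (idem {A ^ᴬ power} A^k-semi u)) ux))
      (λ x y → let u , ux = onto x ; v , vy = onto y in
        functional (∙-closed ux vy) (subst (_∼ _) (sym (comm {A ^ᴬ power} A^k-semi u v)) (∙-closed vy ux)))
      where
      open Cover (proj₁ (HSPfin⇒cover A B B∈K))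
      functional : Functional _∼_
      functional = proj₂ (HSPfin⇒cover A B B∈K)
      A^k-semi = ^-semilattice A power A-semi
      ∙-closed : ∀ {u v x y} → u ∼ x → v ∼ y → meet (A ^ᴬ power) u v ∼ meet B x y
      ∙-closed ux vy = closed m (Pointwise-subst (sym binary) ux vy)

    infix 4 _∣_≤_

    -- This unfolds to the equation `x ≡ meet B x y`: an atomic formula, with a meaning in every B.
    _∣_≤_ : (B : FiniteAlgebra S) → Carrier B → Carrier B → Set
    _∣_≤_ B = NaturalOrder._≤_ _≡_ (meet B)

    ≤? : (B : FiniteAlgebra S) → Decidable₂ (B ∣_≤_)
    ≤? B = NaturalOrder.dec _≡_ (meet B) (Finite-≟ (finite B))

    hom-monotone : (B C : FiniteAlgebra S) {h : Carrier B → Carrier C} → IsHomomorphism B C h →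
      ∀ {x y} → B ∣ x ≤ y → C ∣ h x ≤ h y
    hom-monotone B C {h} h-hom x≤y = trans (cong h x≤y) (meet-hom B C h-hom _ _)

    module _ (B : FiniteAlgebra S) (B-semi : Semilattice B) where

      least : {P : Pred (Carrier B) 0ℓ} → Decidable P → (∀ {x y} → P x → P y → P (meet B x y)) →
        ∃ P → ∃[ m ] (P m × ∀ x → P x → B ∣ m ≤ x)
      least {P} P? P-∙ (x₀ , px₀) =
        let m , pm , m-least = least-among (from (proj₂ (finite B))) in
        m , pm , λ x px →
          subst (B ∣ m ≤_) (strictlyInverseʳ (proj₂ (finite B)) x)
            (m-least _ (subst P (sym (strictlyInverseʳ (proj₂ (finite B)) x)) px))
        where
        open NaturalOrder _≡_ (meet B) using (x∙y≤x; x∙y≤y) renaming (trans to ≤-trans)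
        semigroup = isSemigroup {B} B-semi
        least-among : ∀ {n} (e : Fin n → Carrier B) → ∃[ m ] (P m × ∀ i → P (e i) → B ∣ m ≤ e i)
        -- `x₀` stands in for the empty meet, as there may be no top element.
        least-among {zero}  e = x₀ , px₀ , λ ()
        least-among {suc n} e with least-among (e ∘ suc) | P? (e zero)
        ... | m , pm , m-least | no ¬p = m , pm , λ { zero p → contradiction p ¬p ; (suc i) → m-least i }
        ... | m , pm , m-least | yes p = meet B (e zero) m , P-∙ p pm , λ
          { zero    _ → x∙y≤x B-semi (e zero) m
          ; (suc i) q → ≤-trans semigroup (x∙y≤y B-semi (e zero) m) (m-least i q)
          }

    -- Homomorphisms into L given by parameters

    module _ (L : FiniteAlgebra S) where

      private
        size = proj₁ (finite L)
        L↔n  = proj₂ (finite L)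

      -- For the intended `p` the left side means that the `j`-th element of L is below `h x`, so
      -- the condition says that `h x` and `l` have the same lower set, hence are equal.
      Fibre : (B : FiniteAlgebra S) → Vec (Carrier B) size → Carrier L → Carrier B → Set
      Fibre B p l x = ∀ j → (B ∣ lookup p j ≤ x) ⇔ (L ∣ from L↔n j ≤ l)

      Total : (B : FiniteAlgebra S) → Vec (Carrier B) size → Set
      Total B p = ∀ x → ∃[ l ] Fibre B p l x

      -- Stated negatively so that it does not presuppose disjoint fibres.
      Preserves : (B : FiniteAlgebra S) → Vec (Carrier B) size → Set
      Preserves B p = ∀ f (xs : Vec (Carrier B) (arity S f)) (ls : Vec (Carrier L) (arity S f)) l →
        op L f ls ≢ l → (∀ i → Fibre B p (lookup ls i) (lookup xs i)) → ¬ Fibre B p l (op B f xs)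

      Apart : (B : FiniteAlgebra S) → Vec (Carrier B) size → Carrier B → Carrier B → Set
      Apart B p a b = ∀ l → ¬ (Fibre B p l a × Fibre B p l b)

      Separable : (B : FiniteAlgebra S) → Carrier B → Carrier B → Set
      Separable B a b = ∃[ p ] (Total B p × Preserves B p × Apart B p a b)

      -- `h` takes the value that totality provides. A failure of the homomorphism law at `f` would
      -- put `op B f xs` into a fibre that `Preserves` forbids; equality in L is decidable, so the
      -- law holds.
      separable⇒hom : ∀ B {a b} → Separable B a b → Σ[ h ∈ _ ] (IsHomomorphism B L h × h a ≢ h b)
      separable⇒hom B {a} {b} (p , total , preserves , apart) =
        h ,
        (λ f xs → sym (decidable-stable (Finite-≟ (finite L) _ _) λ op≢ →
          preserves f xs (map h xs) _ op≢
            (λ i → subst (λ l → Fibre B p l (lookup xs i)) (sym (lookup-map i h xs)) (h-fibre (lookup xs i)))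
            (h-fibre (op B f xs)))) ,
        λ ha≡hb → apart (h a) (h-fibre a , subst (λ l → Fibre B p l b) (sym ha≡hb) (h-fibre b))
        where
        h : Carrier B → Carrier L
        h x = proj₁ (total x)
        h-fibre : ∀ x → Fibre B p (h x) x
        h-fibre x = proj₂ (total x)

      -- The fibres of h are cut out by the least elements of the preimages
      -- of the principal filters of L.
      hom⇒separable : ∀ B → Semilattice L → Semilattice B → ((h , _) : B ↠ L) →
        ∀ {a b} → h a ≢ h b → Separable B a b
      hom⇒separable B L-semi B-semi (h , h-hom , h-surj) {a} {b} ha≢hb =
        p ,
        (λ x → h x , h-fibre x) ,
        (λ f xs ls l op≢l fibres fibre → op≢l (begin
          op L f ls          ≡⟨ cong (op L f) (lookup-ext λ i → trans (sym (fibre⇒≡ (fibres i))) (sym (lookup-map i h xs))) ⟩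
          op L f (map h xs)  ≡⟨ h-hom f xs ⟨
          h (op B f xs)      ≡⟨ fibre⇒≡ fibre ⟩
          l                  ∎)) ,
        λ l (la , lb) → ha≢hb (trans (fibre⇒≡ la) (sym (fibre⇒≡ lb)))
        where
        open ≡-Reasoning
        open NaturalOrder _≡_ (meet L) using (∙-presʳ-≤) renaming (refl to ≤-refl; antisym to ≤-antisym; trans to ≤-trans)
        lookup-ext : ∀ {k} {xs ys : Vec (Carrier L) k} → (∀ i → lookup xs i ≡ lookup ys i) → xs ≡ ys
        lookup-ext {xs = xs} {ys} eq =
          trans (sym (tabulate∘lookup xs)) (trans (tabulate-cong eq) (tabulate∘lookup ys))
        generator : ∀ l → ∃[ m ] (L ∣ l ≤ h m × ∀ x → L ∣ l ≤ h x → B ∣ m ≤ x)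
        generator l = least B B-semi (λ x → ≤? L l (h x))
          (λ {x} {y} l≤hx l≤hy → subst (L ∣ l ≤_) (sym (meet-hom B L h-hom x y)) (∙-presʳ-≤ L-semi l l≤hx l≤hy))
          -- Surjectivity makes the preimage of the filter of `l` nonempty.
          (let x , hx≡l = h-surj l in x , subst (L ∣ l ≤_) (sym (hx≡l refl)) (≤-refl sym (idem {L} L-semi)))
        p : Vec (Carrier B) size
        p = tabulate λ j → proj₁ (generator (from L↔n j))
        p≤⇔≤h : ∀ j x → (B ∣ lookup p j ≤ x) ⇔ (L ∣ from L↔n j ≤ h x)
        p≤⇔≤h j x =
          let l≤hm , m-least = proj₂ (generator (from L↔n j)) in
          subst (λ m → (B ∣ m ≤ x) ⇔ (L ∣ from L↔n j ≤ h x)) (sym (lookup∘tabulate _ j)) (mk⇔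
            (λ m≤x → ≤-trans (isSemigroup {L} L-semi) l≤hm (hom-monotone B L h-hom m≤x))
            (m-least x))
        h-fibre : ∀ x → Fibre B p (h x) x
        h-fibre x j = p≤⇔≤h j x
        -- Comparing lower sets at the two points `h x` and `l` gives both inequalities.
        fibre⇒≡ : ∀ {l x} → Fibre B p l x → h x ≡ l
        fibre⇒≡ {l} {x} fibre = ≤-antisym ≡.isEquivalence (comm {L} L-semi)
          (to⇔ (below (h x)) (≤-refl sym (idem {L} L-semi)))
          (from⇔ (below l) (≤-refl sym (idem {L} L-semi)))
          where
          below : ∀ l′ → (L ∣ l′ ≤ h x) ⇔ (L ∣ l′ ≤ l)
          below l′ = subst (λ k → (L ∣ k ≤ h x) ⇔ (L ∣ k ≤ l)) (strictlyInverseʳ L↔n l′)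
            (mk⇔ (to⇔ (fibre j) ∘ from⇔ (p≤⇔≤h j x)) (to⇔ (p≤⇔≤h j x) ∘ from⇔ (fibre j)))
            where j = to L↔n l′

      fibreᵈ : ∀ {n} (p : (B : FiniteAlgebra S) → Vec (Carrier B) n → Vec (Carrier B) size) {x : ElementFamily n} →
        (∀ j → DefinableElement (λ B ρ → lookup (p B ρ) j)) → ∀ l → DefinableElement x →
        Definable (λ B ρ → Fibre B (p B ρ) l (x B ρ))
      fibreᵈ p pᵈ l x = ⋀ᵈ (_ , ↔-refl) λ j →
        (pᵈ j ≐ᵈ meetᵈ (pᵈ j) x) ⇔ᵈ constantᵈ (≤? L (from L↔n j) l)

      -- Environments list the innermost variable first: `b` is quantified inside `a`, so it is the
      -- head, and the parameters come before both.
      separableᵈ : Finite (Op S) → Definable {2} (λ B ρ → Separable B (head (tail ρ)) (head ρ))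
      separableᵈ Op-finite = ∃ᵈ^ size (totalᵈ ∧ᵈ preservesᵈ ∧ᵈ apartᵈ)
        where
        parameterᵈ : ∀ j → DefinableElement {size + 2} (λ B ρ → lookup (prefix size ρ) j)
        parameterᵈ j = variableᵈ (j ↑ˡ 2) λ B ρ → sym (lookup∘tabulate _ j)

        totalᵈ : Definable {size + 2} (λ B ρ → Total B (prefix size ρ))
        totalᵈ = ∀ᵈ (⋁ᵈ (finite L) λ l → fibreᵈ (λ B ρ → prefix size (tail ρ))
          (λ j → variableᵈ (suc (j ↑ˡ 2)) λ { B (x ∷ ρ) → sym (lookup∘tabulate _ j) }) l
          (variableᵈ zero λ { B (x ∷ ρ) → refl }))

        preservesᵈ : Definable {size + 2} (λ B ρ → Preserves B (prefix size ρ))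
        preservesᵈ = ⋀ᵈ Op-finite λ f → ∀ᵈ^ (arity S f)
          (⋀ᵈ (Finite-Vec (finite L) (arity S f)) λ ls → ⋀ᵈ (finite L) λ l →
            constantᵈ (¬? (Finite-≟ (finite L) (op L f ls) l)) ⇒ᵈ
            (⋀ᵈ (arity S f , ↔-refl) λ i → fibreᵈ (p (arity S f)) (pᵈ (arity S f)) (lookup ls i) (xᵈ (arity S f) i)) ⇒ᵈ
            ¬ᵈ fibreᵈ (p (arity S f)) (pᵈ (arity S f)) l (opᵈ f (xᵈ (arity S f))))
          where
          module _ (k : ℕ) where
            p : (B : FiniteAlgebra S) → Vec (Carrier B) (k + (size + 2)) → Vec (Carrier B) size
            p B ρ = prefix size (suffix k ρ)
            pᵈ : ∀ j → DefinableElement (λ B ρ → lookup (p B ρ) j)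
            pᵈ j = variableᵈ (k ↑ʳ (j ↑ˡ 2)) λ B ρ →
              sym (trans (lookup∘tabulate (λ i → lookup (suffix k ρ) (i ↑ˡ 2)) j)
                         (lookup∘tabulate (λ i → lookup ρ (k ↑ʳ i)) (j ↑ˡ 2)))
            xᵈ : ∀ i → DefinableElement {k + (size + 2)} (λ B ρ → lookup (prefix k ρ) i)
            xᵈ i = variableᵈ (i ↑ˡ (size + 2)) λ B ρ → sym (lookup∘tabulate _ i)

        apartᵈ : Definable {size + 2} (λ B ρ →
          Apart B (prefix size ρ) (head (tail (suffix size ρ))) (head (suffix size ρ)))
        apartᵈ = ⋀ᵈ (finite L) λ l → ¬ᵈ
          (fibreᵈ (λ B ρ → prefix size ρ) parameterᵈ l (variableᵈ (size ↑ʳ suc zero) λ _ _ → refl) ∧ᵈ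
           fibreᵈ (λ B ρ → prefix size ρ) parameterᵈ l (variableᵈ (size ↑ʳ zero) λ _ _ → refl))

    -- The defining sentence

    module _ (A : FiniteAlgebra S) {n} (L : Fin n → FiniteAlgebra S) (member? : ∀ i → Dec (HSPfin A (L i))) where

      -- `HSPfin A (L i)` lives in `Set₁`, whereas `Holds` is valued in `Set`; `True (member? i)` is
      -- its small, decidable substitute.
      Residual : FiniteAlgebra S → Set
      Residual B = ∀ a b → a ≡ b ⊎ (∃[ i ] (True (member? i) × Separable (L i) B a b))

      residualᵈ : Finite (Op S) → Definable {0} (λ B _ → Residual B)
      residualᵈ Op-finite = ∀ᵈ (∀ᵈ (equalᵈ ∨ᵈ
        ⋁ᵈ (n , ↔-refl) λ i → constantᵈ (T? _) ∧ᵈ separableᵈ (L i) Op-finite))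
        where
        equalᵈ : Definable {2} (λ B ρ → head (tail ρ) ≡ head ρ)
        equalᵈ = variableᵈ (suc zero) (λ { B (b ∷ a ∷ []) → refl }) ≐ᵈ variableᵈ zero (λ { B (b ∷ a ∷ []) → refl })

      Residual⇒HSPfin : ∀ B → Residual B → HSPfin A B
      Residual⇒HSPfin B residual = residual⇒HSPfin A B λ a b a≢b → separating a≢b (residual a b)
        where
        separating : ∀ {a b} → a ≢ b → a ≡ b ⊎ (∃[ i ] (True (member? i) × Separable (L i) B a b)) →
          Σ[ L ∈ FiniteAlgebra S ] (HSPfin A L × Σ[ h ∈ _ ] (IsHomomorphism B L h × h a ≢ h b))
        separating a≢b (inj₁ a≡b)                   = contradiction a≡b a≢b
        separating a≢b (inj₂ (i , L∈K , separable)) = L i , toWitness L∈K , separable⇒hom (L i) B separable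

      -- The subdirectly irreducible quotient that separates a and b lies in K, so it is isomorphic
      -- to some `L i`. That `L i` is then itself a quotient of B, hence passes the membership test.
      HSPfin⇒Residual : Finite (Op S) → Semilattice A →
        (∀ Q → HSPfin A Q → SubdirectlyIrreducible Q → ∃[ i ] Q ≅ L i) →
        ∀ B → HSPfin A B → Residual B
      HSPfin⇒Residual Op-finite A-semi represented B B∈K a b =
        [ inj₁ , (λ a≢b → inj₂ (separate (subdirectlyIrreducible-quotient Op-finite B a≢b))) ]′
          (toSum (Finite-≟ (finite B) a b))
        where
        HSPfin-quotient : ∀ C → B ↠ C → HSPfin A C
        HSPfin-quotient C B↠C =
          let D , D∈SP , D↠B = B∈K in D , D∈SP , ↠-trans D B C D↠B B↠C

        separate-by : ∀ i → ((h , _) : B ↠ L i) → h a ≢ h b → True (member? i) × Separable (L i) B a b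
        separate-by i B↠Lᵢ ha≢hb =
          fromWitness Lᵢ∈K ,
          hom⇒separable (L i) B (HSPfin⇒semilattice A (L i) A-semi Lᵢ∈K) (HSPfin⇒semilattice A B A-semi B∈K)
            B↠Lᵢ ha≢hb
          where
          Lᵢ∈K : HSPfin A (L i)
          Lᵢ∈K = HSPfin-quotient (L i) B↠Lᵢ

        separate : Σ[ Q ∈ FiniteAlgebra S ] (SubdirectlyIrreducible Q × Σ[ (q , _) ∈ B ↠ Q ] q a ≢ q b) →
          ∃[ i ] (True (member? i) × Separable (L i) B a b)
        separate (Q , Q-si , B↠Q , qa≢qb) =
          let i , g , g-hom , g-injective , g-surj = represented Q (HSPfin-quotient Q B↠Q) Q-si in
          i , separate-by i (↠-trans B Q (L i) B↠Q (g , g-hom , g-surj)) (qa≢qb ∘ g-injective)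

corollary6p3 : (S : Signature) → Finite (Op S) → (A : FiniteAlgebra S) → SemilatticeBased A →
    FinitelyManyUpToIso (λ B → HSPfin A B × SubdirectlyIrreducible B) →
    ∃[ φ ] (∀ (B : FiniteAlgebra S) → (B ⊨ φ) ⇔ HSPfin A B)
corollary6p3 S Op-finite A (m , binary , A-semi) (Ls , represented) =
  Definable.formula φ , λ B →
    mk⇔ (Residual⇒HSPfin A L member? B) (HSPfin⇒Residual A L member? Op-finite A-semi represented′ B)
    ⇔-∘ Definable.correct φ B []
  where
  open Meet {S} m binary
  L : Fin (length Ls) → FiniteAlgebra S
  L = List.lookup Ls
  member? : ∀ i → Dec (HSPfin A (L i))
  member? i = HSPfin? Op-finite A (L i)
  φ : Definable (λ B _ → Residual A L member? B)
  φ = residualᵈ A L member? Op-finite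
  represented′ : ∀ Q → HSPfin A Q → SubdirectlyIrreducible Q → ∃[ i ] Q ≅ L i
  represented′ Q Q∈K Q-si = Any.index (represented Q (Q∈K , Q-si)) , lookup-index (represented Q (Q∈K , Q-si))
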